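{- For each $n$ and $p=p(n)\in[0,1]$, let $\mathcal{A}\subseteq S_{n+1}$ be the random set obtained by picking each $\rho\in S_{n+1}$ independently with probability $p$. There exist real-valued functions $\varepsilon^*(n)\to0$ and $\varepsilon(n)\to0$ (as $n\to\infty$) such that, for every sequence $p=p(n)\in[0,1]$: (1) if $p\le\frac{\log n}{n}(1+\varepsilon^*(n))$ for all sufficiently large $n$, then $\mathbb{P}(\mathcal{A}\text{ is a cover of }S_n)\to0$ as $n\to\infty$; (2) if $p\ge\frac{\log n}{n}(1+\varepsilon(n))$ for all sufficiently large $n$, then $\mathbb{P}(\mathcal{A}\text{ is a cover of }S_n)\to1$ as $n\to\infty$.
   Context: $S_n$ is the set of all permutations of $[n]=\{1,2,\ldots,n\}$, written as words. A permutation $\rho\in S_{n+1}$ covers $\pi\in S_n$ if $\rho$ has a (not necessarily contiguous) subsequence of length $n$ that is order-isomorphic to $\pi$. A set $\mathcal{A}\subseteq S_{n+1}$ is a cover of $S_n$ if every $\pi\in S_n$ is covered by at least one element of $\mathcal{A}$. $\log$ is the natural logarithm. -}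

module Defs where

open import Data.Nat.Base as ℕ using (ℕ; zero; suc; NonZero)
import Data.Nat.Properties as ℕ
open import Data.Nat.Tactic.RingSolver using (solve-∀)
open import Data.Integer.Base as ℤ using (+_)
import Data.Integer.Properties as ℤ
open import Data.Rational.Base as ℚ using (ℚ; 0ℚ; 1ℚ; ½)
import Data.Rational.Properties as ℚ
open import Data.Rational.Solver using (module +-*-Solver)
open import Data.Rational.Unnormalised.Base as ℚᵘ using (mkℚᵘ; *≡*; *≤*)
import Data.Rational.Unnormalised.Properties as ℚᵘ
open import Data.Fin.Base as Fin using (Fin)
import Data.Fin.Properties as Fin
open import Data.List.Base as List
  using (List; []; _∷_; [_]; _++_; map; filter; foldr; length; allFin; cartesianProductWith)
open import Data.List.Membership.Propositional using (_∈_; find; lose)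
import Data.List.Membership.Propositional.Properties as ∈
open import Data.List.Relation.Unary.All using (All; all?)
open import Data.List.Relation.Unary.Any using (Any; any?; here)
open import Data.List.Relation.Binary.Sublist.Propositional using (_⊆_)
import Data.List.Relation.Binary.Sublist.DecPropositional as DecSublist
open import Data.Product.Base using (∃; _×_; _,_)
open import Data.Sum.Base using (inj₁; inj₂)
open import Data.Vec.Base as Vec using (Vec; []; _∷_; lookup; toList)
open import Data.Vec.Relation.Unary.Unique.Propositional using (Unique)
import Data.Vec.Relation.Unary.AllPairs as AllPairs
open import Level using (0ℓ)
open import Function.Bundles using (_⇔_; mk⇔; Equivalence)
open import Relation.Binary.PropositionalEquality hiding ([_])
open import Relation.Nullary using (Dec)
open import Relation.Nullary.Decidable using (map′; _×-dec_; _→-dec_; ¬?)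
open import Relation.Unary using (Pred; Decidable)

∣∣≤ : ∀ {p ε} → p ℚ.≤ ε → ℚ.- p ℚ.≤ ε → ℚ.∣ p ∣ ℚ.≤ ε
∣∣≤ {p} p≤ε -p≤ε with ℚ.∣p∣≡p∨∣p∣≡-p p
... | inj₁ eq = subst (ℚ._≤ _) (sym eq) p≤ε
... | inj₂ eq = subst (ℚ._≤ _) (sym eq) -p≤ε

≤-from-shift : ∀ {p q r} → p ℚ.≤ q ℚ.+ r → p ℚ.- q ℚ.≤ r
≤-from-shift {p} {q} {r} h = subst (p ℚ.- q ℚ.≤_)
  (solve 2 (λ q r → (q :+ r) :- q := r) refl q r)
  (ℚ.+-monoˡ-≤ (ℚ.- q) h)
  where open +-*-Solver

halves : ∀ ε → ½ ℚ.* ε ℚ.+ ½ ℚ.* ε ≡ ε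
halves ε = trans (sym (ℚ.*-distribʳ-+ ε ½ ½)) (ℚ.*-identityˡ ε)

*-pos : ∀ {p q} → 0ℚ ℚ.< p → 0ℚ ℚ.< q → 0ℚ ℚ.< p ℚ.* q
*-pos {p} {q} 0<p 0<q = subst (ℚ._< p ℚ.* q) (ℚ.*-zeroʳ p)
  (ℚ.*-monoʳ-<-pos p {{ℚ.positive 0<p}} 0<q)

½-pos : ∀ {ε} → 0ℚ ℚ.< ε → 0ℚ ℚ.< ½ ℚ.* ε
½-pos = *-pos (ℚ.positive⁻¹ ½)

∣-∣-swap : ∀ p q → ℚ.∣ p ℚ.- q ∣ ≡ ℚ.∣ q ℚ.- p ∣
∣-∣-swap p q = trans (cong ℚ.∣_∣ (solve 2 (λ p q → p :- q := :- (q :- p)) refl p q))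
                     (ℚ.∣-p∣≡∣p∣ (q ℚ.- p))
  where open +-*-Solver

∣∣≤∣-∣+∣∣ : ∀ p q → ℚ.∣ p ∣ ℚ.≤ ℚ.∣ q ∣ ℚ.+ ℚ.∣ p ℚ.- q ∣
∣∣≤∣-∣+∣∣ p q = subst (λ z → ℚ.∣ z ∣ ℚ.≤ ℚ.∣ q ∣ ℚ.+ ℚ.∣ p ℚ.- q ∣)
  (solve 2 (λ p q → q :+ (p :- q) := p) refl p q)
  (ℚ.∣p+q∣≤∣p∣+∣q∣ q (p ℚ.- q))
  where open +-*-Solver

*-mono-≤-abs : ∀ a b {c d} → ℚ.∣ a ∣ ℚ.≤ c → ℚ.∣ b ∣ ℚ.≤ d → ℚ.∣ a ℚ.* b ∣ ℚ.≤ c ℚ.* d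
*-mono-≤-abs a b {c} {d} a≤c b≤d = begin
  ℚ.∣ a ℚ.* b ∣         ≡⟨ ℚ.∣p*q∣≡∣p∣*∣q∣ a b ⟩
  ℚ.∣ a ∣ ℚ.* ℚ.∣ b ∣   ≤⟨ ℚ.*-monoˡ-≤-nonNeg ℚ.∣ a ∣ {{ℚ.∣-∣-nonNeg a}} b≤d ⟩
  ℚ.∣ a ∣ ℚ.* d         ≤⟨ ℚ.*-monoʳ-≤-nonNeg d {{ℚ.nonNegative 0≤d}} a≤c ⟩
  c ℚ.* d               ∎
  where
  open ℚ.≤-Reasoning
  0≤d = ℚ.≤-trans (ℚ.0≤∣p∣ b) b≤d

-- Reals are Cauchy sequences of rationals.  There is no quotient:
-- equality of reals is mutual _≤_.

Cauchy : (ℕ → ℚ) → Set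
Cauchy x = ∀ ε → 0ℚ ℚ.< ε →
  ∃ λ N → ∀ m n → N ℕ.≤ m → N ℕ.≤ n → ℚ.∣ x m ℚ.- x n ∣ ℚ.≤ ε

record ℝ : Set where
  constructor mkℝ
  field
    seq    : ℕ → ℚ
    cauchy : Cauchy seq

open ℝ public

infix  4 _≤_
infixl 6 _+_ _-_
infixl 7 _*_ _÷_
infix  8 -_
infixr 8 _^_

_≤_ : ℝ → ℝ → Set
x ≤ y = ∀ ε → 0ℚ ℚ.< ε → ∃ λ N → ∀ n → N ℕ.≤ n → seq x n ℚ.≤ seq y n ℚ.+ ε

fromℚ : ℚ → ℝ
fromℚ q = mkℝ (λ _ → q) λ ε 0<ε → 0 , λ _ _ _ _ →
  subst (λ z → ℚ.∣ z ∣ ℚ.≤ ε) (sym (ℚ.+-inverseʳ q)) (ℚ.<⇒≤ 0<ε)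

0ℝ 1ℝ : ℝ
0ℝ = fromℚ 0ℚ
1ℝ = fromℚ 1ℚ

_+_ : ℝ → ℝ → ℝ
mkℝ x cx + mkℝ y cy = mkℝ (λ n → x n ℚ.+ y n) λ ε 0<ε →
  let N₁ , h₁ = cx (½ ℚ.* ε) (½-pos 0<ε)
      N₂ , h₂ = cy (½ ℚ.* ε) (½-pos 0<ε)
  in N₁ ℕ.⊔ N₂ , λ m n N≤m N≤n → begin
    ℚ.∣ (x m ℚ.+ y m) ℚ.- (x n ℚ.+ y n) ∣
      ≡⟨ cong ℚ.∣_∣ (solve 4 (λ a b c d → (a :+ b) :- (c :+ d) := (a :- c) :+ (b :- d))
                       refl (x m) (y m) (x n) (y n)) ⟩
    ℚ.∣ (x m ℚ.- x n) ℚ.+ (y m ℚ.- y n) ∣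
      ≤⟨ ℚ.∣p+q∣≤∣p∣+∣q∣ (x m ℚ.- x n) (y m ℚ.- y n) ⟩
    ℚ.∣ x m ℚ.- x n ∣ ℚ.+ ℚ.∣ y m ℚ.- y n ∣
      ≤⟨ ℚ.+-mono-≤ (h₁ m n (ℕ.m⊔n≤o⇒m≤o N₁ N₂ N≤m) (ℕ.m⊔n≤o⇒m≤o N₁ N₂ N≤n))
                    (h₂ m n (ℕ.m⊔n≤o⇒n≤o N₁ N₂ N≤m) (ℕ.m⊔n≤o⇒n≤o N₁ N₂ N≤n)) ⟩
    ½ ℚ.* ε ℚ.+ ½ ℚ.* ε
      ≡⟨ halves ε ⟩
    ε ∎
  where
  open ℚ.≤-Reasoning
  open +-*-Solver

-_ : ℝ → ℝ
- mkℝ x cx = mkℝ (λ n → ℚ.- x n) λ ε 0<ε →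
  let N , h = cx ε 0<ε
  in N , λ m n N≤m N≤n → subst (ℚ._≤ ε)
    (trans (∣-∣-swap (x m) (x n))
           (cong ℚ.∣_∣ (solve 2 (λ a b → b :- a := :- a :- :- b) refl (x m) (x n))))
    (h m n N≤m N≤n)
  where open +-*-Solver

_-_ : ℝ → ℝ → ℝ
x - y = x + (- y)

bounded : ∀ x → Cauchy x →
  ∃ λ B → (0ℚ ℚ.< B) × ∃ λ N → ∀ n → N ℕ.≤ n → ℚ.∣ x n ∣ ℚ.≤ B
bounded x cx =
  let N , h = cx 1ℚ (ℚ.positive⁻¹ 1ℚ)
  in ℚ.∣ x N ∣ ℚ.+ 1ℚ
   , ℚ.+-mono-≤-< (ℚ.0≤∣p∣ (x N)) (ℚ.positive⁻¹ 1ℚ)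
   , N , λ n N≤n → ℚ.≤-trans (∣∣≤∣-∣+∣∣ (x n) (x N))
                     (ℚ.+-monoʳ-≤ ℚ.∣ x N ∣ (h n N N≤n ℕ.≤-refl))

scale : ∀ {ε} → 0ℚ ℚ.< ε → ∀ {B} → 0ℚ ℚ.< B → ∃ λ δ → (0ℚ ℚ.< δ) × (B ℚ.* δ ≡ ε)
scale {ε} 0<ε {B} 0<B =
    ℚ.1/_ B {{nz}} ℚ.* ε
  , *-pos (ℚ.positive⁻¹ (ℚ.1/_ B {{nz}}) {{ℚ.1/pos⇒pos B {{ℚ.positive 0<B}}}}) 0<ε
  , trans (sym (ℚ.*-assoc B (ℚ.1/_ B {{nz}}) ε))
      (trans (cong (ℚ._* ε) (ℚ.*-inverseʳ B {{nz}})) (ℚ.*-identityˡ ε))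
  where nz = ℚ.pos⇒nonZero B {{ℚ.positive 0<B}}

_*_ : ℝ → ℝ → ℝ
mkℝ x cx * mkℝ y cy = mkℝ (λ n → x n ℚ.* y n) λ ε 0<ε →
  let Bx , 0<Bx , K₁ , bx = bounded x cx
      By , 0<By , K₂ , by = bounded y cy
      δ₁ , 0<δ₁ , e₁ = scale (½-pos 0<ε) 0<Bx
      δ₂ , 0<δ₂ , e₂ = scale (½-pos 0<ε) 0<By
      N₁ , h₁ = cy δ₁ 0<δ₁
      N₂ , h₂ = cx δ₂ 0<δ₂
      K = K₁ ℕ.⊔ K₂
      N = N₁ ℕ.⊔ N₂
  in K ℕ.⊔ N , λ m n M≤m M≤n →
    let K≤m = ℕ.m⊔n≤o⇒m≤o K N M≤m
        K≤n = ℕ.m⊔n≤o⇒m≤o K N M≤n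
        N≤m = ℕ.m⊔n≤o⇒n≤o K N M≤m
        N≤n = ℕ.m⊔n≤o⇒n≤o K N M≤n
    in begin
    ℚ.∣ x m ℚ.* y m ℚ.- x n ℚ.* y n ∣
      ≡⟨ cong ℚ.∣_∣ (solve 4 (λ a b c d → a :* b :- c :* d := a :* (b :- d) :+ d :* (a :- c))
                       refl (x m) (y m) (x n) (y n)) ⟩
    ℚ.∣ x m ℚ.* (y m ℚ.- y n) ℚ.+ y n ℚ.* (x m ℚ.- x n) ∣
      ≤⟨ ℚ.∣p+q∣≤∣p∣+∣q∣ (x m ℚ.* (y m ℚ.- y n)) (y n ℚ.* (x m ℚ.- x n)) ⟩
    ℚ.∣ x m ℚ.* (y m ℚ.- y n) ∣ ℚ.+ ℚ.∣ y n ℚ.* (x m ℚ.- x n) ∣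
      ≤⟨ ℚ.+-mono-≤
           (*-mono-≤-abs (x m) (y m ℚ.- y n) (bx m (ℕ.m⊔n≤o⇒m≤o K₁ K₂ K≤m))
              (h₁ m n (ℕ.m⊔n≤o⇒m≤o N₁ N₂ N≤m) (ℕ.m⊔n≤o⇒m≤o N₁ N₂ N≤n)))
           (*-mono-≤-abs (y n) (x m ℚ.- x n) (by n (ℕ.m⊔n≤o⇒n≤o K₁ K₂ K≤n))
              (h₂ m n (ℕ.m⊔n≤o⇒n≤o N₁ N₂ N≤m) (ℕ.m⊔n≤o⇒n≤o N₁ N₂ N≤n))) ⟩
    Bx ℚ.* δ₁ ℚ.+ By ℚ.* δ₂
      ≡⟨ cong₂ ℚ._+_ e₁ e₂ ⟩
    ½ ℚ.* ε ℚ.+ ½ ℚ.* ε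
      ≡⟨ halves ε ⟩
    ε ∎
  where
  open ℚ.≤-Reasoning
  open +-*-Solver

∣_∣ : ℝ → ℝ
∣ mkℝ x cx ∣ = mkℝ (λ n → ℚ.∣ x n ∣) λ ε 0<ε →
  let N , h = cx ε 0<ε
  in N , λ m n N≤m N≤n → ℚ.≤-trans
    (∣∣≤ (≤-from-shift (∣∣≤∣-∣+∣∣ (x m) (x n)))
         (subst₂ ℚ._≤_
           (solve 2 (λ a b → b :- a := :- (a :- b)) refl ℚ.∣ x m ∣ ℚ.∣ x n ∣)
           (∣-∣-swap (x n) (x m))
           (≤-from-shift (∣∣≤∣-∣+∣∣ (x n) (x m)))))
    (h m n N≤m N≤n)
  where open +-*-Solver

_^_ : ℝ → ℕ → ℝ
x ^ zero  = 1ℝ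
x ^ suc n = x * x ^ n

_÷_ : ℝ → (n : ℕ) → .{{NonZero n}} → ℝ
x ÷ n = x * fromℚ (+ 1 ℚ./ n)

sumℝ : List ℝ → ℝ
sumℝ = foldr _+_ 0ℝ

Eventually : (ℕ → Set) → Set
Eventually P = ∃ λ N → ∀ n → N ℕ.≤ n → P n

infix 4 _⟶_

_⟶_ : (ℕ → ℝ) → ℝ → Set
x ⟶ l = ∀ ε → 0ℚ ℚ.< ε → Eventually λ n → ∣ x n - l ∣ ≤ fromℚ ε

-- The natural logarithm of a positive integer n, as ∫₁ⁿ dt/t.
--
-- With mesh 1/M, the right-endpoint Riemann sum of the integral has the
-- (n-1)M terms  (1/M) · 1/(1 + (i+1)/M) = 1/(M+i+1),  0 ≤ i < (n-1)M.

recip : ℕ → ℚ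
recip k = + 1 ℚ./ suc k

Σ< : ℕ → (ℕ → ℚ) → ℚ
Σ< zero    f = 0ℚ
Σ< (suc k) f = Σ< k f ℚ.+ f k

riemannSum : ℕ → ℕ → ℚ
riemannSum n M = Σ< (ℕ.pred n ℕ.* M) λ i → + 1 ℚ./ suc (M ℕ.+ i)

Σ<-cong : ∀ k {f g} → (∀ i → f i ≡ g i) → Σ< k f ≡ Σ< k g
Σ<-cong zero    e = refl
Σ<-cong (suc k) e = cong₂ ℚ._+_ (Σ<-cong k e) (e k)

Σ<-mono : ∀ k {f g} → (∀ i → i ℕ.< k → f i ℚ.≤ g i) → Σ< k f ℚ.≤ Σ< k g
Σ<-mono zero    h = ℚ.≤-refl
Σ<-mono (suc k) h = ℚ.+-mono-≤ (Σ<-mono k λ i i<k → h i (ℕ.m<n⇒m<1+n i<k)) (h k ℕ.≤-refl)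

Σ<-+ : ∀ a b f → Σ< (a ℕ.+ b) f ≡ Σ< a f ℚ.+ Σ< b (λ r → f (a ℕ.+ r))
Σ<-+ a zero    f = trans (cong (λ z → Σ< z f) (ℕ.+-identityʳ a)) (sym (ℚ.+-identityʳ _))
Σ<-+ a (suc b) f = begin
  Σ< (a ℕ.+ suc b) f                                     ≡⟨ cong (λ z → Σ< z f) (ℕ.+-suc a b) ⟩
  Σ< (a ℕ.+ b) f ℚ.+ f (a ℕ.+ b)                         ≡⟨ cong (ℚ._+ f (a ℕ.+ b)) (Σ<-+ a b f) ⟩
  Σ< a f ℚ.+ Σ< b (λ r → f (a ℕ.+ r)) ℚ.+ f (a ℕ.+ b)    ≡⟨ ℚ.+-assoc (Σ< a f) _ _ ⟩
  Σ< a f ℚ.+ (Σ< b (λ r → f (a ℕ.+ r)) ℚ.+ f (a ℕ.+ b))  ∎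
  where open ≡-Reasoning

Σ<-* : ∀ a b f → Σ< (a ℕ.* b) f ≡ Σ< a (λ i → Σ< b (λ r → f (i ℕ.* b ℕ.+ r)))
Σ<-* zero    b f = refl
Σ<-* (suc a) b f = trans (cong (λ z → Σ< z f) (ℕ.+-comm b (a ℕ.* b)))
  (trans (Σ<-+ (a ℕ.* b) b f) (cong (ℚ._+ Σ< b (λ r → f (a ℕ.* b ℕ.+ r))) (Σ<-* a b f)))

/-+1 : ∀ a d → (+ a ℚ./ suc d) ℚ.+ (+ 1 ℚ./ suc d) ≡ + suc a ℚ./ suc d
/-+1 a d = ℚ.toℚᵘ-injective (begin
  ℚ.toℚᵘ ((+ a ℚ./ suc d) ℚ.+ (+ 1 ℚ./ suc d))
    ≈⟨ ℚ.toℚᵘ-homo-+ (+ a ℚ./ suc d) (+ 1 ℚ./ suc d) ⟩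
  ℚ.toℚᵘ (+ a ℚ./ suc d) ℚᵘ.+ ℚ.toℚᵘ (+ 1 ℚ./ suc d)
    ≈⟨ ℚᵘ.+-cong (ℚ.toℚᵘ-fromℚᵘ (mkℚᵘ (+ a) d)) (ℚ.toℚᵘ-fromℚᵘ (mkℚᵘ (+ 1) d)) ⟩
  mkℚᵘ (+ a) d ℚᵘ.+ mkℚᵘ (+ 1) d
    ≈⟨ *≡* eq ⟩
  mkℚᵘ (+ suc a) d
    ≈⟨ ℚ.toℚᵘ-fromℚᵘ (mkℚᵘ (+ suc a) d) ⟨
  ℚ.toℚᵘ (+ suc a ℚ./ suc d) ∎)
  where
  open ℚᵘ.≃-Reasoning
  D = + suc d
  eq : (+ a ℤ.* D ℤ.+ + 1 ℤ.* D) ℤ.* D ≡ + suc a ℤ.* (D ℤ.* D)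
  eq = trans (cong (ℤ._* D) (trans (sym (ℤ.*-distribʳ-+ D (+ a) (+ 1)))
               (cong (λ z → + z ℤ.* D) (ℕ.+-comm a 1))))
             (ℤ.*-assoc (+ suc a) D D)

Σ<-const : ∀ k d → Σ< k (λ _ → recip d) ≡ + k ℚ./ suc d
Σ<-const zero    d = sym (ℚ.0/n≡0 (suc d))
Σ<-const (suc k) d = trans (cong (ℚ._+ recip d) (Σ<-const k d)) (/-+1 k d)

-- k/(jk) = 1/j for positive j and k
/-cancel : ∀ k j d → suc d ≡ suc j ℕ.* suc k → + suc k ℚ./ suc d ≡ recip j
/-cancel k j d e = ℚ.fromℚᵘ-cong {mkℚᵘ (+ suc k) d} {mkℚᵘ (+ 1) j} (*≡*
  (trans (sym (ℤ.pos-* (suc k) (suc j)))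
    (trans (cong +_ (trans (ℕ.*-comm (suc k) (suc j)) (trans (sym e) (sym (ℕ.*-identityˡ (suc d))))))
      (ℤ.pos-* 1 (suc d)))))

recip-anti : ∀ {a b} → a ℕ.≤ b → recip b ℚ.≤ recip a
recip-anti {a} {b} a≤b = ℚ.toℚᵘ-cancel-≤ (begin
  ℚ.toℚᵘ (recip b)  ≃⟨ ℚ.toℚᵘ-fromℚᵘ (mkℚᵘ (+ 1) b) ⟩
  mkℚᵘ (+ 1) b      ≤⟨ *≤* (ℤ.*-monoˡ-≤-nonNeg (+ 1) (ℤ.+≤+ (ℕ.s≤s a≤b))) ⟩
  mkℚᵘ (+ 1) a      ≃⟨ ℚ.toℚᵘ-fromℚᵘ (mkℚᵘ (+ 1) a) ⟨
  ℚ.toℚᵘ (recip a)  ∎)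
  where open ℚᵘ.≤-Reasoning

0≤recip : ∀ k → 0ℚ ℚ.≤ recip k
0≤recip k = ℚ.nonNegative⁻¹ (recip k) {{ℚ.normalize-nonNeg 1 (suc k)}}

-- 1/(j+2) ≤ Σ_{r<k} 1/((j+1)k + r + 1) ≤ 1/(j+1)
block-lower : ∀ k j → recip (suc j) ℚ.≤ Σ< (suc k) (λ r → recip (suc j ℕ.* suc k ℕ.+ r))
block-lower k j = begin
  recip (suc j)                    ≡⟨ /-cancel k (suc j) (k ℕ.+ suc j ℕ.* suc k) refl ⟨
  + suc k ℚ./ suc (k ℕ.+ suc j ℕ.* suc k)
                                   ≡⟨ Σ<-const (suc k) (k ℕ.+ suc j ℕ.* suc k) ⟨
  Σ< (suc k) (λ _ → recip (k ℕ.+ suc j ℕ.* suc k))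
    ≤⟨ Σ<-mono (suc k) (λ r r<k → recip-anti
         (ℕ.≤-trans (ℕ.+-monoʳ-≤ (suc j ℕ.* suc k) (ℕ.s≤s⁻¹ r<k))
           (ℕ.≤-reflexive (ℕ.+-comm (suc j ℕ.* suc k) k)))) ⟩
  Σ< (suc k) (λ r → recip (suc j ℕ.* suc k ℕ.+ r)) ∎
  where open ℚ.≤-Reasoning

block-upper : ∀ k j → Σ< (suc k) (λ r → recip (suc j ℕ.* suc k ℕ.+ r)) ℚ.≤ recip j
block-upper k j = begin
  Σ< (suc k) (λ r → recip (suc j ℕ.* suc k ℕ.+ r))
    ≤⟨ Σ<-mono (suc k) (λ r _ → recip-anti
         (ℕ.≤-trans (ℕ.n≤1+n _) (ℕ.m≤m+n (suc j ℕ.* suc k) r))) ⟩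
  Σ< (suc k) (λ _ → recip (k ℕ.+ j ℕ.* suc k))  ≡⟨ Σ<-const (suc k) (k ℕ.+ j ℕ.* suc k) ⟩
  + suc k ℚ./ suc (k ℕ.+ j ℕ.* suc k)           ≡⟨ /-cancel k j (k ℕ.+ j ℕ.* suc k) refl ⟩
  recip j                                       ∎
  where open ℚ.≤-Reasoning

telescope : ∀ m l →
  Σ< l (λ i → recip (m ℕ.+ i)) ℚ.+ recip (m ℕ.+ l) ≡ Σ< l (λ i → recip (suc m ℕ.+ i)) ℚ.+ recip m
telescope m zero    = cong (λ z → 0ℚ ℚ.+ recip z) (ℕ.+-identityʳ m)
telescope m (suc l) = begin
  A ℚ.+ recip (m ℕ.+ l) ℚ.+ recip (m ℕ.+ suc l)
    ≡⟨ cong₂ ℚ._+_ (telescope m l) (cong recip (ℕ.+-suc m l)) ⟩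
  B ℚ.+ recip m ℚ.+ recip (suc m ℕ.+ l)
    ≡⟨ solve 3 (λ a b c → a :+ b :+ c := a :+ c :+ b) refl B (recip m) (recip (suc m ℕ.+ l)) ⟩
  B ℚ.+ recip (suc m ℕ.+ l) ℚ.+ recip m ∎
  where
  open ≡-Reasoning
  open +-*-Solver
  A = Σ< l (λ i → recip (m ℕ.+ i))
  B = Σ< l (λ i → recip (suc m ℕ.+ i))

refine : ∀ n m k → riemannSum n (suc m ℕ.* suc k) ≡
  Σ< (ℕ.pred n ℕ.* suc m) (λ i → Σ< (suc k) (λ r → recip ((suc m ℕ.+ i) ℕ.* suc k ℕ.+ r)))
refine n m k = trans
  (cong (λ z → Σ< z (λ i → recip (suc m ℕ.* suc k ℕ.+ i)))
    (sym (ℕ.*-assoc (ℕ.pred n) (suc m) (suc k))))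
  (trans (Σ<-* (ℕ.pred n ℕ.* suc m) (suc k) _)
    (Σ<-cong (ℕ.pred n ℕ.* suc m) λ i → Σ<-cong (suc k) λ r → cong recip (regroup (suc m) (suc k) i r)))
  where
  regroup : ∀ M K i r → M ℕ.* K ℕ.+ (i ℕ.* K ℕ.+ r) ≡ (M ℕ.+ i) ℕ.* K ℕ.+ r
  regroup = solve-∀

refine-lower : ∀ n m k → riemannSum n (suc m) ℚ.≤ riemannSum n (suc m ℕ.* suc k)
refine-lower n m k = subst (riemannSum n (suc m) ℚ.≤_) (sym (refine n m k))
  (Σ<-mono (ℕ.pred n ℕ.* suc m) λ i _ → block-lower k (m ℕ.+ i))

refine-upper : ∀ n m k → riemannSum n (suc m ℕ.* suc k) ℚ.≤ riemannSum n (suc m) ℚ.+ recip m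
refine-upper n m k = begin
  riemannSum n (suc m ℕ.* suc k)                   ≡⟨ refine n m k ⟩
  Σ< L (λ i → Σ< (suc k) (λ r → recip ((suc m ℕ.+ i) ℕ.* suc k ℕ.+ r)))
    ≤⟨ Σ<-mono L (λ i _ → block-upper k (m ℕ.+ i)) ⟩
  Σ< L (λ i → recip (m ℕ.+ i))                     ≡⟨ ℚ.+-identityʳ _ ⟨
  Σ< L (λ i → recip (m ℕ.+ i)) ℚ.+ 0ℚ              ≤⟨ ℚ.+-monoʳ-≤ (Σ< L (λ i → recip (m ℕ.+ i))) (0≤recip (m ℕ.+ L)) ⟩
  Σ< L (λ i → recip (m ℕ.+ i)) ℚ.+ recip (m ℕ.+ L) ≡⟨ telescope m L ⟩
  riemannSum n (suc m) ℚ.+ recip m                 ∎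
  where
  open ℚ.≤-Reasoning
  L = ℕ.pred n ℕ.* suc m

archimedean : ∀ ε → 0ℚ ℚ.< ε → ∃ λ N → recip N ℚ.≤ ε
archimedean ε@(ℚ.mkℚ (+ suc a) d _) _ = d , ℚ.toℚᵘ-cancel-≤ (begin
  ℚ.toℚᵘ (recip d)  ≃⟨ ℚ.toℚᵘ-fromℚᵘ (mkℚᵘ (+ 1) d) ⟩
  mkℚᵘ (+ 1) d      ≤⟨ *≤* (ℤ.*-monoʳ-≤-nonNeg (+ suc d) {+ 1} {+ suc a} (ℤ.+≤+ (ℕ.s≤s ℕ.z≤n))) ⟩
  ℚ.toℚᵘ ε          ∎)
  where open ℚᵘ.≤-Reasoning
archimedean (ℚ.mkℚ (+ zero) d _) (ℚ.*<* (ℤ.+<+ ()))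
archimedean (ℚ.mkℚ ℤ.-[1+ _ ] d _) (ℚ.*<* ())

riemannSum-close : ∀ n m m′ → riemannSum n (suc m) ℚ.≤ riemannSum n (suc m′) ℚ.+ recip m′
riemannSum-close n m m′ = ℚ.≤-trans (refine-lower n m m′)
  (subst (λ z → riemannSum n z ℚ.≤ riemannSum n (suc m′) ℚ.+ recip m′)
    (ℕ.*-comm (suc m′) (suc m)) (refine-upper n m′ m))

riemannSum-cauchy : ∀ n → Cauchy (λ m → riemannSum n (suc m))
riemannSum-cauchy n ε 0<ε =
  let N , h = archimedean ε 0<ε
      step : ∀ m m′ → N ℕ.≤ m′ → riemannSum n (suc m) ℚ.- riemannSum n (suc m′) ℚ.≤ ε
      step m m′ N≤m′ = ≤-from-shift (ℚ.≤-trans (riemannSum-close n m m′)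
        (ℚ.+-monoʳ-≤ (riemannSum n (suc m′)) (ℚ.≤-trans (recip-anti N≤m′) h)))
  in N , λ m m′ N≤m N≤m′ → ∣∣≤ (step m m′ N≤m′)
       (subst (ℚ._≤ ε) (solve 2 (λ a b → b :- a := :- (a :- b)) refl
                         (riemannSum n (suc m)) (riemannSum n (suc m′)))
              (step m′ m N≤m))
  where open +-*-Solver

log : (n : ℕ) → .{{NonZero n}} → ℝ
log n = mkℝ (λ m → riemannSum n (suc m)) (riemannSum-cauchy n)

-- Words use the letters 0, …, m-1 rather than 1, …, m; only the relative
-- order of letters matters for covering.

Word : ℕ → ℕ → Set
Word m k = Vec (Fin m) k

words : ∀ m k → List (Word m k)
words m zero    = [ [] ]
words m (suc k) = cartesianProductWith _∷_ (allFin m) (words m k)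

unique? : ∀ {m k} → Decidable (Unique {A = Fin m} {k})
unique? = AllPairs.allPairs? λ i j → ¬? (i Fin.≟ j)

S : (n : ℕ) → List (Word n n)
S n = filter unique? (words n n)

infix 4 _≅_ _Covers_

_≅_ : ∀ {a b k} → Word a k → Word b k → Set
u ≅ v = ∀ i j → (lookup u i Fin.< lookup u j) ⇔ (lookup v i Fin.< lookup v j)

_Covers_ : ∀ {n} → Word (suc n) (suc n) → Word n n → Set
_Covers_ {n} ρ π = ∃ λ (w : Word (suc n) n) → (toList w ⊆ toList ρ) × (w ≅ π)

IsCover : (n : ℕ) → List (Word (suc n) (suc n)) → Set
IsCover n A = All (λ π → Any (_Covers π) A) (S n)

∈-words : ∀ {m k} (w : Word m k) → w ∈ words m k
∈-words []      = here refl
∈-words (i ∷ w) = ∈.∈-cartesianProductWith⁺ _∷_ (∈.∈-allFin i) (∈-words w)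

≅? : ∀ {a b k} (u : Word a k) (v : Word b k) → Dec (u ≅ v)
≅? u v = Fin.all? λ i → Fin.all? λ j →
  let d = lookup u i Fin.<? lookup u j
      e = lookup v i Fin.<? lookup v j
  in map′ (λ (f , g) → mk⇔ f g) (λ h → Equivalence.to h , Equivalence.from h)
       ((d →-dec e) ×-dec (e →-dec d))

covers? : ∀ {n} (ρ : Word (suc n) (suc n)) (π : Word n n) → Dec (ρ Covers π)
covers? {n} ρ π = map′ (λ a → let w , _ , h = find a in w , h)
                       (λ (w , h) → lose (∈-words w) h)
  (any? (λ w → (toList w ⊆? toList ρ) ×-dec ≅? w π) (words (suc n) n))
  where open DecSublist Fin._≟_ using (_⊆?_)

isCover? : ∀ n → Decidable (IsCover n)
isCover? n A = all? (λ π → any? (λ ρ → covers? ρ π) A) (S n)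

subsets : ∀ {X : Set} → List X → List (List X)
subsets []       = [ [] ]
subsets (x ∷ xs) = map (x ∷_) (subsets xs) ++ subsets xs

-- For a duplicate-free list xs with N elements, weight p N A is the
-- probability of the outcome A when each element of xs is picked
-- independently with probability p.

weight : ∀ {X : Set} → ℝ → ℕ → List X → ℝ
weight p N A = p ^ length A * (1ℝ - p) ^ (N ℕ.∸ length A)

ℙ : ∀ {X : Set} {P : Pred (List X) 0ℓ} → ℝ → List X → Decidable P → ℝ
ℙ p xs P? = sumℝ (map (weight p (length xs)) (filter P? (subsets xs)))

ℙ-cover : ℕ → ℝ → ℝ
ℙ-cover n p = ℙ p (S (suc n)) (isCover? n)

{-# OPTIONS --safe #-}

-- Up to an additive constant log n is the harmonic sum H = 1/2 + … + 1/n, so with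
-- p = (H + O(1))/n the AM-GM inequality compares (1-p)^n with the telescoping products
-- ∏ (1 + 1/i) = n and ∏ (1 - 1/j) = 1/n, and ε, ε* may be taken to be multiples of 1/(H + 1).
-- A permutation π has between n(n-1) and (n+1)² covers, so the expected number of uncovered π
-- is n! (1-p)^(n² + O(n)).  For p ≥ (H + 1)/n this is at most 2/n, and the union bound applies.
-- For p ≤ (H + 1 - C)/n it is exponentially large; two uncovering events are
-- independent unless they share a cover, which happens for at most (n+1)³ partners of π, so
-- Chebyshev's inequality applies.
-- All probabilities are polynomials in p, hence are computed termwise on a rational
-- Cauchy sequence representing p and may be estimated at rational arguments.

module Submission where

open import Defs using
  ( ℝ; mkℝ; seq; cauchy; Cauchy; fromℚ; 0ℝ; 1ℝ; log; _÷_; sumℝ; _⟶_; Eventually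
  ; Word; words; S; unique?; _≅_; _Covers_; covers?; isCover?; ∈-words
  ; subsets; weight; ℙ; ℙ-cover
  ; recip; 0≤recip; recip-anti; archimedean; scale; halves; ½-pos; *-pos
  ; ∣-∣-swap; ∣∣≤; ≤-from-shift
  ; Σ<; Σ<-cong; Σ<-+; Σ<-const; telescope; block-lower; riemannSum; riemannSum-close; refine-lower )
open import Algebra.Bundles using (CommutativeRing)
open import Data.Empty using (⊥-elim)
open import Data.Fin.Base as Fin using (Fin; zero; suc; toℕ; fromℕ<; punchIn; punchOut; inject₁)
import Data.Fin.Properties as Fin
import Data.Integer.Properties as ℤ
open import Data.List.Base as List
  using (List; []; _∷_; _++_; allFin; cartesianProduct; filter; length)
open import Data.List.Membership.Propositional using (_∈_)
import Data.List.Membership.Propositional.Properties as ∈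
import Data.List.Properties as List
import Data.List.Relation.Binary.Pointwise as Pointwise
import Data.List.Relation.Binary.Sublist.Heterogeneous.Properties as Sublist
open import Data.List.Relation.Binary.Sublist.Propositional using (_⊆_; []; _∷_; _∷ʳ_; ⊆-refl)
import Data.List.Relation.Unary.All as ListAll
import Data.List.Relation.Unary.All.Properties as ListAll
open import Data.List.Relation.Unary.AllPairs using ([]; _∷_)
open import Data.List.Relation.Unary.Any as Any using (Any; here; there; any?)
import Data.List.Relation.Unary.Any.Properties as Any
import Data.List.Relation.Unary.Unique.Propositional as List
import Data.List.Relation.Unary.Unique.Propositional.Properties as ListUnique
open import Data.Nat.Base as ℕ using (ℕ; zero; suc; pred; s≤s; z≤n; NonZero; _!)
import Data.Nat.Properties as ℕ
open import Data.Nat.Tactic.RingSolver using (solve-∀)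
open import Data.Product.Base using (∃; ∃₂; _×_; _,_; proj₁; proj₂)
open import Data.Rational.Base as ℚ using (ℚ; 0ℚ; 1ℚ; ½)
import Data.Rational.Properties as ℚ
open import Data.Rational.Solver using (module +-*-Solver)
open import Data.Rational.Unnormalised.Base using (mkℚᵘ; *≡*)
open import Data.Sum.Base using (_⊎_; inj₁; inj₂)
open import Data.Vec.Base using (Vec; []; _∷_; lookup; map; toList; insertAt; removeAt)
import Data.Vec.Properties as Vec
open import Data.Vec.Relation.Unary.All as All using (All; []; _∷_)
import Data.Vec.Relation.Unary.All.Properties as All
open import Data.Vec.Relation.Unary.AllPairs using ([]; _∷_)
open import Data.Vec.Relation.Unary.Unique.Propositional using (Unique)
import Data.Vec.Relation.Unary.Unique.Propositional.Properties as Unique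
open import Function.Base using (_∘_)
open import Function.Bundles using (mk⇔; Equivalence)
open import Level using (0ℓ)
open import Relation.Binary.Definitions using (tri<; tri≈; tri>)
open import Relation.Binary.PropositionalEquality
open import Relation.Nullary using (Dec; yes; no; ¬_)
open import Relation.Unary using (Pred; Decidable)

-- With y = 1 - p, the quantity n! y^(n² + O(n)) is read as about n copies of y^n * n, because n! is
-- n^n up to an exponential factor. A constant added to np multiplies y^n * n by a constant, hence
-- the expected number of uncovered words by an exponential in n. A large enough constant therefore
-- beats both the crude Stirling bound and every polynomial loss, including the linear uncertainty
-- in the number of covers. In the other direction there is no such room: n! ≤ 2 n^(n-2) saves
-- exactly the factors of n that make y^n * n ≤ 1 sufficient. Only n-th powers of rationals occur,
-- so neither exponentials nor roots have to be constructed. The remaining obstacle is that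
-- inequalities between reals hold only up to every positive error. The rational terms representing
-- p may leave the interval in which the estimates are valid, so they are first moved back into it,
-- and continuity of the cover probability shows that this changes nothing in the limit.

-- Powers, products and the AM-GM inequality over the rationals.

module RationalArithmetic where
  open import Data.Integer.Base using (+_)
  open import Algebra.Properties.CommutativeSemiring.Exp
    (CommutativeRing.commutativeSemiring ℚ.+-*-commutativeRing) public
    using (_^_; ^-homo-*; ^-assocʳ; ^-distrib-*)
  import Algebra.Properties.Semiring.Mult
    (CommutativeRing.semiring ℚ.+-*-commutativeRing) as Mult
  open import Data.Rational.Base using (_≤_; _<_; _+_; _*_; _-_; -_; ∣_∣)
  open +-*-Solver using (solve; _:+_; _:*_; _:-_; :-_; _:=_; con)

  0≤1 : 0ℚ ≤ 1ℚ
  0≤1 = ℚ.nonNegative⁻¹ 1ℚ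

  0<1 : 0ℚ < 1ℚ
  0<1 = ℚ.positive⁻¹ 1ℚ

  *-monoˡ-≤ : ∀ {r p q} → 0ℚ ≤ r → p ≤ q → r * p ≤ r * q
  *-monoˡ-≤ {r} 0≤r = ℚ.*-monoˡ-≤-nonNeg r {{ℚ.nonNegative 0≤r}}

  *-monoʳ-≤ : ∀ {r p q} → 0ℚ ≤ r → p ≤ q → p * r ≤ q * r
  *-monoʳ-≤ {r} 0≤r = ℚ.*-monoʳ-≤-nonNeg r {{ℚ.nonNegative 0≤r}}

  *-mono-≤ : ∀ {p q r s} → 0ℚ ≤ p → p ≤ q → 0ℚ ≤ s → r ≤ s → p * r ≤ q * s
  *-mono-≤ 0≤p p≤q 0≤s r≤s = ℚ.≤-trans (*-monoˡ-≤ 0≤p r≤s) (*-monoʳ-≤ 0≤s p≤q)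

  0≤* : ∀ {p q} → 0ℚ ≤ p → 0ℚ ≤ q → 0ℚ ≤ p * q
  0≤* {p} {q} 0≤p 0≤q = subst (_≤ p * q) (ℚ.*-zeroʳ p) (*-monoˡ-≤ 0≤p 0≤q)

  0≤+ : ∀ {p q} → 0ℚ ≤ p → 0ℚ ≤ q → 0ℚ ≤ p + q
  0≤+ = ℚ.+-mono-≤

  *-cancelʳ-≤ : ∀ {r p q} → 0ℚ < r → p * r ≤ q * r → p ≤ q
  *-cancelʳ-≤ {r} 0<r = ℚ.*-cancelʳ-≤-pos r {{ℚ.positive 0<r}}

  0≤² : ∀ p → 0ℚ ≤ p * p
  0≤² p = subst (0ℚ ≤_) (trans (sym (ℚ.∣p*q∣≡∣p∣*∣q∣ p p)) eq) (0≤* (ℚ.0≤∣p∣ p) (ℚ.0≤∣p∣ p))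
    where
    eq : ℚ.∣ p * p ∣ ≡ p * p
    eq with ℚ.∣p∣≡p∨∣p∣≡-p p
    ... | inj₁ e = trans (ℚ.∣p*q∣≡∣p∣*∣q∣ p p) (cong₂ _*_ e e)
    ... | inj₂ e = trans (ℚ.∣p*q∣≡∣p∣*∣q∣ p p)
      (trans (cong₂ _*_ e e) (solve 1 (λ p → (:- p) :* (:- p) := p :* p) refl p))

  diff⇒≤ : ∀ {p q} → 0ℚ ≤ q - p → p ≤ q
  diff⇒≤ {p} {q} h = subst₂ _≤_ (ℚ.+-identityˡ p)
    (solve 2 (λ p q → q :- p :+ p := q) refl p q) (ℚ.+-monoˡ-≤ p h)

  ≤⇒diff : ∀ {p q} → p ≤ q → 0ℚ ≤ q - p
  ≤⇒diff {p} {q} h = subst (_≤ q - p) (ℚ.+-inverseʳ p) (ℚ.+-monoˡ-≤ (- p) h)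

  x≤x+y : ∀ x {y} → 0ℚ ≤ y → x ≤ x + y
  x≤x+y x {y} 0≤y = subst (_≤ x + y) (ℚ.+-identityʳ x) (ℚ.+-monoʳ-≤ x 0≤y)

  1-x≤1 : ∀ {x} → 0ℚ ≤ x → 1ℚ - x ≤ 1ℚ
  1-x≤1 {x} 0≤x = diff⇒≤ (subst (0ℚ ≤_) (solve 1 (λ x → x := con 1ℚ :- (con 1ℚ :- x)) refl x) 0≤x)

  0≤^ : ∀ {x} → 0ℚ ≤ x → ∀ n → 0ℚ ≤ x ^ n
  0≤^ 0≤x zero    = 0≤1
  0≤^ 0≤x (suc n) = 0≤* 0≤x (0≤^ 0≤x n)

  0<^ : ∀ {x} → 0ℚ < x → ∀ n → 0ℚ < x ^ n
  0<^ 0<x zero    = 0<1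
  0<^ 0<x (suc n) = *-pos 0<x (0<^ 0<x n)

  ^-monoˡ-≤ : ∀ n {x y} → 0ℚ ≤ x → x ≤ y → x ^ n ≤ y ^ n
  ^-monoˡ-≤ zero    0≤x x≤y = ℚ.≤-refl
  ^-monoˡ-≤ (suc n) 0≤x x≤y =
    *-mono-≤ 0≤x x≤y (0≤^ (ℚ.≤-trans 0≤x x≤y) n) (^-monoˡ-≤ n 0≤x x≤y)

  1^ : ∀ n → 1ℚ ^ n ≡ 1ℚ
  1^ zero    = refl
  1^ (suc n) = trans (ℚ.*-identityˡ _) (1^ n)

  ^-antimonoʳ-≤ : ∀ {x m n} → 0ℚ ≤ x → x ≤ 1ℚ → m ℕ.≤ n → x ^ n ≤ x ^ m
  ^-antimonoʳ-≤ {x} {n = n} 0≤x x≤1 ℕ.z≤n =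
    subst (x ^ n ≤_) (1^ n) (^-monoˡ-≤ n 0≤x x≤1)
  ^-antimonoʳ-≤ 0≤x x≤1 (ℕ.s≤s m≤n) = *-monoˡ-≤ 0≤x (^-antimonoʳ-≤ 0≤x x≤1 m≤n)

  -- As a repeated sum, `ι (suc n)` unfolds to `1ℚ + ι n`, the form in which the ring solver sees it
  -- throughout.
  ι : ℕ → ℚ
  ι n = n Mult.× 1ℚ

  ι-* : ∀ m n → ι (m ℕ.* n) ≡ ι m * ι n
  ι-* = Mult.×1-homo-*

  ι-^ : ∀ m n → ι (m ℕ.^ n) ≡ ι m ^ n
  ι-^ m zero    = ℚ.+-identityʳ 1ℚ
  ι-^ m (suc n) = trans (ι-* m (m ℕ.^ n)) (cong (ι m *_) (ι-^ m n))

  0≤ι : ∀ n → 0ℚ ≤ ι n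
  0≤ι zero    = ℚ.≤-refl
  0≤ι (suc n) = 0≤+ 0≤1 (0≤ι n)

  0<ι : ∀ n → 0ℚ < ι (suc n)
  0<ι n = ℚ.+-mono-<-≤ 0<1 (0≤ι n)

  ι-mono : ∀ {m n} → m ℕ.≤ n → ι m ≤ ι n
  ι-mono {n = n} ℕ.z≤n   = 0≤ι n
  ι-mono (ℕ.s≤s m≤n) = ℚ.+-monoʳ-≤ 1ℚ (ι-mono m≤n)

  -- Joins the two encodings, repeated sums for `ι` and reduced fractions for `recip`: k + 1 copies
  -- of 1/(k+1) add up to (k+1)/(k+1).
  ι-suc-recip : ∀ k → ι (suc k) * recip k ≡ 1ℚ
  ι-suc-recip k = trans (sum-const (suc k)) (trans (Σ<-const (suc k) k) cancel)
    where
    sum-const : ∀ n {x} → ι n * x ≡ Σ< n (λ _ → x)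
    sum-const zero    {x} = ℚ.*-zeroˡ x
    sum-const (suc n) {x} = trans (solve 2 (λ m x → (con 1ℚ :+ m) :* x := m :* x :+ x) refl (ι n) x)
                              (cong (_+ x) (sum-const n))
    cancel : + suc k ℚ./ suc k ≡ 1ℚ
    cancel = ℚ.fromℚᵘ-cong {mkℚᵘ (+ suc k) k} {mkℚᵘ (+ 1) 0} (*≡* (ℤ.*-comm (+ suc k) (+ 1)))

  -- The tangent line of z ↦ z^(k+1) at x lies below the graph.
  tangent : ∀ k {m x} → 0ℚ ≤ m → 0ℚ ≤ x →
    x ^ k * (ι (suc k) * m - ι k * x) ≤ m ^ suc k
  tangent zero {m} {x} _ _ = ℚ.≤-reflexive
    (solve 2 (λ m x → con 1ℚ :* ((con 1ℚ :+ con 0ℚ) :* m :- con 0ℚ :* x) := m :* con 1ℚ) refl m x)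
  tangent (suc k) {m} {x} 0≤m 0≤x = ℚ.≤-trans
    -- Multiplying the induction hypothesis by `m` overshoots the new left side by x^k (k+1) (m -
    -- x)².
    (diff⇒≤ (subst (0ℚ ≤_)
      (solve 4 (λ p c m x → p :* ((con 1ℚ :+ c) :* ((m :- x) :* (m :- x))) :=
          m :* (p :* ((con 1ℚ :+ c) :* m :- c :* x))
          :- x :* p :* ((con 1ℚ :+ (con 1ℚ :+ c)) :* m :- (con 1ℚ :+ c) :* x))
        refl (x ^ k) (ι k) m x)
      (0≤* (0≤^ 0≤x k) (0≤* (0≤ι (suc k)) (0≤² (m - x))))))
    (*-monoˡ-≤ 0≤m (tangent k 0≤m 0≤x))

  Π< : ℕ → (ℕ → ℚ) → ℚ
  Π< zero    f = 1ℚ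
  Π< (suc k) f = Π< k f * f k

  Σ<-nonneg : ∀ n {a} → (∀ i → 0ℚ ≤ a i) → 0ℚ ≤ Σ< n a
  Σ<-nonneg zero    h = ℚ.≤-refl
  Σ<-nonneg (suc n) h = 0≤+ (Σ<-nonneg n h) (h n)

  Π<-nonneg : ∀ n {a} → (∀ i → 0ℚ ≤ a i) → 0ℚ ≤ Π< n a
  Π<-nonneg zero    h = 0≤1
  Π<-nonneg (suc n) h = 0≤* (Π<-nonneg n h) (h n)

  -- The first n numbers have mean `x`, so their product is at most x^n by induction; the last
  -- number is at most (n+1)m - nx, and `tangent` finishes. A bound `m` on the mean together with a
  -- power of `m` avoids roots. The case of one number is separate because `x` divides by n.
  am-gm : ∀ n {a m} → (∀ i → 0ℚ ≤ a i) → 0ℚ ≤ m → Σ< n a ≤ ι n * m → Π< n a ≤ m ^ n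
  am-gm zero    h 0≤m s = ℚ.≤-refl
  am-gm (suc zero) {a} {m} h 0≤m s = subst₂ _≤_
    (solve 1 (λ x → con 0ℚ :+ x := con 1ℚ :* x) refl (a 0))
    (solve 1 (λ x → (con 1ℚ :+ con 0ℚ) :* x := x :* con 1ℚ) refl m) s
  am-gm (suc n@(suc k)) {a} {m} h 0≤m s = begin
    Π< n a * a n                         ≤⟨ *-monoʳ-≤ (h n)
      (am-gm n h 0≤x (ℚ.≤-reflexive (sym nx))) ⟩
    x ^ n * a n                          ≤⟨ *-monoˡ-≤ (0≤^ 0≤x n) b≤ ⟩
    x ^ n * (ι (suc n) * m - ι n * x)    ≤⟨ tangent n 0≤m 0≤x ⟩
    m ^ suc n                            ∎
    where
    open ℚ.≤-Reasoning
    x = Σ< n a * recip k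
    0≤x : 0ℚ ≤ x
    0≤x = 0≤* (Σ<-nonneg n h) (0≤recip k)
    nx : ι n * x ≡ Σ< n a
    nx = trans (solve 3 (λ i s r → i :* (s :* r) := s :* (i :* r)) refl (ι n) (Σ< n a) (recip k))
      (trans (cong (Σ< n a *_) (ι-suc-recip k)) (ℚ.*-identityʳ _))
    b≤ : a n ≤ ι (suc n) * m - ι n * x
    b≤ = subst₂ _≤_ (solve 2 (λ s b → s :+ b :- s := b) refl (Σ< n a) (a n))
      (cong (λ z → ι (suc n) * m - z) (sym nx)) (ℚ.+-monoˡ-≤ (- Σ< n a) s)

open RationalArithmetic

-- Harmonic sums, factorials and the two numerical regimes.

module HarmonicEstimates where
  open import Data.Rational.Base using (_≤_; _<_; _+_; _*_; _-_; -_; ∣_∣)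
  open +-*-Solver using (solve; _:+_; _:*_; _:-_; :-_; _:=_; con)

  -- The last term is 1/(k+1), so `H k` is the harmonic sum that belongs to n = k + 1.
  H : ℕ → ℚ
  H k = Σ< k λ i → recip (suc i)

  0≤H : ∀ k → 0ℚ ≤ H k
  0≤H k = Σ<-nonneg k λ i → 0≤recip (suc i)

  ι-recip : ∀ k → recip k * ι (suc k) ≡ 1ℚ
  ι-recip k = trans (ℚ.*-comm (recip k) (ι (suc k))) (ι-suc-recip k)

  recip≤1 : ∀ k → recip k ≤ 1ℚ
  recip≤1 k = recip-anti {0} {k} ℕ.z≤n

  H≤ι : ∀ k → H k ≤ ι k
  H≤ι zero    = ℚ.≤-refl
  H≤ι (suc k) = subst (H (suc k) ≤_) (ℚ.+-comm (ι k) 1ℚ) (ℚ.+-mono-≤ (H≤ι k) (recip≤1 (suc k)))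

  H-mono : ∀ {j k} → j ℕ.≤ k → H j ≤ H k
  H-mono {j} {k} j≤k = subst (λ z → H j ≤ H z) (ℕ.m+[n∸m]≡n j≤k)
    (subst₂ _≤_ (ℚ.+-identityʳ (H j)) (sym (Σ<-+ j (k ℕ.∸ j) (λ i → recip (suc i))))
      (ℚ.+-monoʳ-≤ (H j) (Σ<-nonneg (k ℕ.∸ j) λ i → 0≤recip (suc (j ℕ.+ i)))))

  double : ℕ → ℕ
  double k = k ℕ.+ suc k

  -- In terms of n = k + 1, `double` sends n to 2n, and the n new terms 1/(n+1), ..., 1/(2n) add up
  -- to at least 1/2. Hence two doublings gain 1 in `H-unbounded`.
  H-double : ∀ k → H k + ½ ≤ H (double k)
  H-double k = begin
    H k + recip 1
      ≤⟨ ℚ.+-monoʳ-≤ (H k) (block-lower k 0) ⟩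
    H k + Σ< (suc k) (λ r → recip (1 ℕ.* suc k ℕ.+ r))
      ≡⟨ cong (H k +_) (Σ<-cong (suc k) λ r →
        cong (λ z → recip (z ℕ.+ r)) (ℕ.*-identityˡ (suc k))) ⟩
    H k + Σ< (suc k) (λ r → recip (suc (k ℕ.+ r)))
      ≡⟨ Σ<-+ k (suc k) (λ i → recip (suc i)) ⟨
    H (double k) ∎
    where open ℚ.≤-Reasoning

  H-unbounded : ∀ K → ∃ λ N → ∀ k → N ℕ.≤ k → ι K ≤ H k
  H-unbounded K = N K , λ k N≤k → ℚ.≤-trans (bound K) (H-mono N≤k)
    where
    N : ℕ → ℕ
    N zero    = 0
    N (suc K) = double (double (N K))
    bound : ∀ K → ι K ≤ H (N K)
    bound zero    = ℚ.≤-refl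
    bound (suc K) = begin
      1ℚ + ι K                  ≤⟨ ℚ.+-monoʳ-≤ 1ℚ (bound K) ⟩
      1ℚ + H (N K)              ≡⟨ solve 1 (λ h → con 1ℚ :+ h := h :+ con ½ :+ con ½) refl
        (H (N K)) ⟩
      H (N K) + ½ + ½           ≤⟨ ℚ.+-monoˡ-≤ ½ (H-double (N K)) ⟩
      H (double (N K)) + ½      ≤⟨ H-double (double (N K)) ⟩
      H (double (double (N K))) ∎
      where open ℚ.≤-Reasoning

  n≤[1+t]^n : ∀ k {t} → 0ℚ ≤ t → H k + 1ℚ ≤ ι (suc k) * t → ι (suc k) ≤ (1ℚ + t) ^ suc k
  n≤[1+t]^n k {t} 0≤t h = subst (_≤ (1ℚ + t) ^ suc k) (prod k)
    (am-gm (suc k) 0≤a (0≤+ 0≤1 0≤t) (begin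
      Σ< (suc k) a                          ≡⟨ sum k ⟩
      ι (suc k) + Σ< k recip                ≤⟨ ℚ.+-monoʳ-≤ (ι (suc k)) Σrecip≤ ⟩
      ι (suc k) + (H k + 1ℚ)                ≤⟨ ℚ.+-monoʳ-≤ (ι (suc k)) h ⟩
      ι (suc k) + ι (suc k) * t             ≡⟨ solve 2
        (λ n t → n :+ n :* t := n :* (con 1ℚ :+ t)) refl (ι (suc k)) t ⟩
      ι (suc k) * (1ℚ + t)                  ∎))
    where
    open ℚ.≤-Reasoning
    a : ℕ → ℚ
    -- The telescoping product 2/1 * 3/2 * ... * (k+1)/k has only k factors; the additional 1 makes
    -- them n, to match the exponent.
    a zero    = 1ℚ
    a (suc i) = 1ℚ + recip i
    0≤a : ∀ i → 0ℚ ≤ a i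
    0≤a zero    = 0≤1
    0≤a (suc i) = 0≤+ 0≤1 (0≤recip i)
    sum : ∀ k → Σ< (suc k) a ≡ ι (suc k) + Σ< k recip
    sum zero    = refl
    sum (suc k) = trans (cong (_+ (1ℚ + recip k)) (sum k))
      (solve 3 (λ i s r → i :+ s :+ (con 1ℚ :+ r) := con 1ℚ :+ i :+ (s :+ r)) refl (ι (suc k))
        (Σ< k recip) (recip k))
    prod : ∀ k → Π< (suc k) a ≡ ι (suc k)
    prod zero    = refl
    prod (suc k) = trans (cong (_* (1ℚ + recip k)) (prod k))
      (trans (solve 2 (λ i r → i :* (con 1ℚ :+ r) := i :* r :+ i) refl (ι (suc k)) (recip k))
        (cong (_+ ι (suc k)) (ι-suc-recip k)))
    Σrecip≤ : Σ< k recip ≤ H k + 1ℚ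
    Σrecip≤ = subst₂ _≤_ (ℚ.+-identityʳ _) (telescope 0 k)
      (ℚ.+-monoʳ-≤ (Σ< k recip) (0≤recip k))

  -- AM-GM for the n numbers c, 1 - 1/2, ..., 1 - 1/n, whose product telescopes to c/n. The free
  -- first factor is how an additive constant in np turns into a multiplicative constant in y^n * n.
  c≤y^n*n : ∀ k {c y} → 0ℚ ≤ c → 0ℚ ≤ y → c + ι k - H k ≤ ι (suc k) * y → c ≤ y ^ suc k * ι (suc k)
  c≤y^n*n k {c} {y} 0≤c 0≤y h = subst (_≤ y ^ suc k * ι (suc k)) (prod k)
    (*-monoʳ-≤ (0≤ι (suc k)) (am-gm (suc k) 0≤a 0≤y (ℚ.≤-trans (ℚ.≤-reflexive (sum k)) h)))
    where
    a : ℕ → ℚ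
    a zero    = c
    a (suc i) = 1ℚ - recip (suc i)
    0≤a : ∀ i → 0ℚ ≤ a i
    0≤a zero    = 0≤c
    0≤a (suc i) = ≤⇒diff (recip≤1 (suc i))
    sum : ∀ k → Σ< (suc k) a ≡ c + ι k - H k
    sum zero    = solve 1 (λ c → con 0ℚ :+ c := c :+ con 0ℚ :- con 0ℚ) refl c
    sum (suc k) = trans (cong (_+ (1ℚ - recip (suc k))) (sum k))
      (solve 4 (λ c i h r → c :+ i :- h :+ (con 1ℚ :- r) := c :+ (con 1ℚ :+ i) :- (h :+ r)) refl c
        (ι k) (H k) (recip (suc k)))
    prod : ∀ k → Π< (suc k) a * ι (suc k) ≡ c
    prod zero    = solve 1 (λ c → con 1ℚ :* c :* (con 1ℚ :+ con 0ℚ) := c) refl c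
    prod (suc k) = trans
      (solve 3 (λ p r i → p :* (con 1ℚ :- r) :* i := p :* (i :- r :* i)) refl (Π< (suc k) a)
        (recip (suc k)) (ι (suc (suc k))))
      (trans (cong (λ z → Π< (suc k) a * (ι (suc (suc k)) - z)) (ι-recip (suc k)))
      (trans (cong (Π< (suc k) a *_) (solve 1 (λ i → con 1ℚ :+ i :- con 1ℚ := i) refl (ι (suc k))))
        (prod k)))

  4ℚ : ℚ
  4ℚ = ι 4

  -- (1 + 1/n)^n ≤ 4, by AM-GM for the n + 2 numbers n/2, n/2, n+1, …, n+1 of mean n.
  [1+n]^n≤4n^n : ∀ n → ι (suc n) ^ n ≤ 4ℚ * ι n ^ n
  [1+n]^n≤4n^n zero = ℚ.≤ᵇ⇒≤ _
  [1+n]^n≤4n^n n@(suc m) = *-cancelʳ-≤ (*-pos (*-pos (ℚ.positive⁻¹ ½) (0<ι m))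
    (*-pos (ℚ.positive⁻¹ ½) (0<ι m)))
    (subst₂ _≤_ (prod n) (solve 2 (λ x p → x :* (x :* p) :=
      con 4ℚ :* p :* (con ½ :* x :* (con ½ :* x))) refl (ι n) (ι n ^ n))
      (am-gm (suc (suc n)) 0≤a (0≤ι n) (ℚ.≤-reflexive (trans (sum n)
        (solve 1 (λ x → x :+ x :* (con 1ℚ :+ x) := (con 1ℚ :+ (con 1ℚ :+ x)) :* x) refl (ι n))))))
    where
    h = ½ * ι n
    a : ℕ → ℚ
    a zero          = h
    a (suc zero)    = h
    a (suc (suc _)) = ι (suc n)
    0≤a : ∀ i → 0ℚ ≤ a i
    0≤a zero          = 0≤* (ℚ.nonNegative⁻¹ ½) (0≤ι n)
    0≤a (suc zero)    = 0≤* (ℚ.nonNegative⁻¹ ½) (0≤ι n)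
    0≤a (suc (suc _)) = 0≤ι (suc n)
    sum : ∀ j → Σ< (suc (suc j)) a ≡ ι n + ι j * ι (suc n)
    sum zero    = solve 1 (λ x → con 0ℚ :+ con ½ :* x :+ con ½ :* x := x :+ con 0ℚ :* (con 1ℚ :+ x))
      refl (ι n)
    sum (suc j) = trans (cong (_+ ι (suc n)) (sum j))
      (solve 3 (λ x j y → x :+ j :* y :+ y := x :+ (con 1ℚ :+ j) :* y) refl (ι n) (ι j) (ι (suc n)))
    prod : ∀ j → Π< (suc (suc j)) a ≡ ι (suc n) ^ j * (h * h)
    prod zero    = solve 1 (λ h → con 1ℚ :* h :* h := con 1ℚ :* (h :* h)) refl h
    prod (suc j) = trans (cong (_* ι (suc n)) (prod j))
      (solve 3 (λ p h y → p :* (h :* h) :* y := y :* p :* (h :* h)) refl (ι (suc n) ^ j) h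
        (ι (suc n)))

  -- A weak Stirling bound with 4 in place of e: passing from n to n + 1 costs one factor (1 +
  -- 1/n)^n ≤ 4.
  n^n≤n!4^n : ∀ n → ι n ^ n ≤ ι (n !) * 4ℚ ^ n
  n^n≤n!4^n zero = ℚ.≤ᵇ⇒≤ _
  n^n≤n!4^n (suc n) = begin
    ι (suc n) * ι (suc n) ^ n             ≤⟨ *-monoˡ-≤ (0≤ι (suc n)) ([1+n]^n≤4n^n n) ⟩
    ι (suc n) * (4ℚ * ι n ^ n)            ≤⟨ *-monoˡ-≤ (0≤ι (suc n))
      (*-monoˡ-≤ (0≤ι 4) (n^n≤n!4^n n)) ⟩
    ι (suc n) * (4ℚ * (ι (n !) * 4ℚ ^ n)) ≡⟨ solve 4
      (λ s c f p → s :* (c :* (f :* p)) := s :* f :* (c :* p)) refl (ι (suc n)) 4ℚ (ι (n !))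
      (4ℚ ^ n) ⟩
    ι (suc n) * ι (n !) * (4ℚ * 4ℚ ^ n)   ≡⟨ cong (_* (4ℚ * 4ℚ ^ n)) (ι-* (suc n) (n !)) ⟨
    ι (suc n !) * 4ℚ ^ suc n              ∎
    where open ℚ.≤-Reasoning

  -- Only the l factors above 2 are replaced by `m`. At m = l + 2 = n this gives n! ≤ 2 n^(n-2), two
  -- powers of n better than n^n, as `upper-regime` requires.
  [2+l]!≤2m^l : ∀ l {m} → suc (suc l) ℕ.≤ m → suc (suc l) ! ℕ.≤ 2 ℕ.* m ℕ.^ l
  [2+l]!≤2m^l zero    _ = ℕ.≤-refl
  [2+l]!≤2m^l (suc l) {m} h = ℕ.≤-trans (ℕ.*-mono-≤ h ([2+l]!≤2m^l l (ℕ.≤-trans (ℕ.n≤1+n _) h)))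
    (ℕ.≤-reflexive (trans (sym (ℕ.*-assoc m 2 _))
      (trans (cong (ℕ._* m ℕ.^ l) (ℕ.*-comm m 2)) (ℕ.*-assoc 2 m _))))

  1+n≤2^n : ∀ n → suc n ℕ.≤ 2 ℕ.^ n
  1+n≤2^n zero    = ℕ.≤-refl
  1+n≤2^n (suc n) = ℕ.≤-trans (ℕ.s≤s (ℕ.m≤n+m (suc n) n))
    (ℕ.≤-trans (ℕ.≤-reflexive (cong (suc n ℕ.+_) (sym (ℕ.+-identityʳ (suc n)))))
    (ℕ.*-monoʳ-≤ 2 (1+n≤2^n n)))

  2ℚ : ℚ
  2ℚ = ι 2

  -- In C = 4·2⁷ the factor 4 pays for n^n ≤ 4^n n!, and 2⁷ for the seven factors
  -- of order n that the second-moment argument loses.  It is kept abstract because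
  -- the unary numeral K = 512 must not be unfolded.
  abstract
    K : ℕ
    K = 4 ℕ.* 2 ℕ.^ 7

    C : ℚ
    C = ι K

    ι-K : ι K ≡ C
    ι-K = refl

    C≡ : C ≡ 4ℚ * 2ℚ ^ 7
    C≡ = trans (ι-* 4 (2 ℕ.^ 7)) (cong (4ℚ *_) (ι-^ 2 7))

    0≤C : 0ℚ ≤ C
    0≤C = 0≤ι K

    1≤C : 1ℚ ≤ C
    1≤C = subst (_≤ ι K) (ℚ.+-identityʳ 1ℚ) (ι-mono {1} {K} (ℕ.s≤s ℕ.z≤n))

  -- Raise C ≤ y^n * n to the power n + 3, which is enough because (n+1)² ≤ n(n+3), and replace n^n
  -- by n! 4^n. This yields μ ≥ 2^(7n) / (n+1)³. Of the seven factors n + 1 bounded by 2^n, three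
  -- pay for this denominator, three for the bound on Pμ, and one is the rate of decay obtained for
  -- `P`.
  lower-regime : ∀ k {y P μ} → let n = suc k in
    0ℚ ≤ y → y ≤ 1ℚ → C + ι k - H k ≤ ι n * y → 0ℚ ≤ P →
    P * μ ≤ ι (suc n) ^ 3 → ι (n !) * y ^ (suc n ℕ.* suc n) ≤ μ → P * ι (suc n) ≤ 1ℚ
  lower-regime k {y} {P} {μ} 0≤y y≤1 h 0≤P Pμ≤ μ≥ =
    *-cancelʳ-≤ (*-pos (0<^ (0<ι 3) n) (0<^ (0<ι n) 6)) (begin
      P * N * (4ℚ ^ n * N ^ 6)
        ≡⟨ solve 4 (λ P N f s → P :* N :* (f :* s) := P :* (f :* (N :* s))) refl P N (4ℚ ^ n)
        (N ^ 6) ⟩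
      P * (4ℚ ^ n * N ^ 7)                    ≤⟨ *-monoˡ-≤ 0≤P (*-monoˡ-≤ (0≤^ (0≤ι 4) n) N^7≤) ⟩
      P * (4ℚ ^ n * (2ℚ ^ 7) ^ n)
        ≡⟨ cong (P *_) (trans (cong (_^ n) C≡) (^-distrib-* 4ℚ (2ℚ ^ 7) n)) ⟨
      P * C ^ n                               ≤⟨ *-monoˡ-≤ 0≤P C^n≤ ⟩
      P * (y ^ n * v) ^ (n ℕ.+ 3)
        ≡⟨ cong (P *_) (trans (^-distrib-* (y ^ n) v (n ℕ.+ 3))
        (cong₂ _*_ (^-assocʳ y n (n ℕ.+ 3)) (^-homo-* v n 3))) ⟩
      P * (y ^ (n ℕ.* (n ℕ.+ 3)) * (v ^ n * v ^ 3))
        ≤⟨ *-monoˡ-≤ 0≤P (*-mono-≤ (0≤^ 0≤y (n ℕ.* (n ℕ.+ 3))) (^-antimonoʳ-≤ 0≤y y≤1 exponents)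
             (0≤* (0≤* (0≤ι (n !)) (0≤^ (0≤ι 4) n)) (0≤^ (0≤ι (suc n)) 3))
             (*-mono-≤ (0≤^ (0≤ι n) n) (n^n≤n!4^n n) (0≤^ (0≤ι (suc n)) 3)
               (^-monoˡ-≤ 3 (0≤ι n) (ι-mono (ℕ.n≤1+n n))))) ⟩
      P * (Y * (ι (n !) * 4ℚ ^ n * N ^ 3))
        ≡⟨ solve 5 (λ P Y F f t → P :* (Y :* (F :* f :* t)) := P :* (F :* Y) :* (f :* t)) refl P Y
        (ι (n !)) (4ℚ ^ n) (N ^ 3) ⟩
      P * (ι (n !) * Y) * (4ℚ ^ n * N ^ 3)
        ≤⟨ *-monoʳ-≤ (0≤* (0≤^ (0≤ι 4) n) (0≤^ (0≤ι (suc n)) 3))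
        (ℚ.≤-trans (*-monoˡ-≤ 0≤P μ≥) Pμ≤) ⟩
      N ^ 3 * (4ℚ ^ n * N ^ 3)
        ≡⟨ solve 2 (λ t f → t :* (f :* t) := con 1ℚ :* (f :* (t :* t))) refl (N ^ 3) (4ℚ ^ n) ⟩
      1ℚ * (4ℚ ^ n * (N ^ 3 * N ^ 3))         ≡⟨ cong (λ z → 1ℚ * (4ℚ ^ n * z)) (^-homo-* N 3 3) ⟨
      1ℚ * (4ℚ ^ n * N ^ 6)                   ∎)
    where
    open ℚ.≤-Reasoning
    n = suc k
    N = ι (suc n)
    v = ι n
    Y = y ^ (suc n ℕ.* suc n)
    N^7≤ : N ^ 7 ≤ (2ℚ ^ 7) ^ n
    N^7≤ = ℚ.≤-trans (^-monoˡ-≤ 7 (0≤ι (suc n))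
      (ℚ.≤-trans (ι-mono (1+n≤2^n n)) (ℚ.≤-reflexive (ι-^ 2 n))))
      (ℚ.≤-reflexive (trans (^-assocʳ 2ℚ n 7)
        (trans (cong (2ℚ ^_) (ℕ.*-comm n 7)) (sym (^-assocʳ 2ℚ 7 n)))))
    1≤^ : ∀ {x} → 1ℚ ≤ x → ∀ n → 1ℚ ≤ x ^ n
    1≤^ {x} 1≤x n = subst (_≤ x ^ n) (1^ n) (^-monoˡ-≤ n 0≤1 1≤x)
    C^n≤ : C ^ n ≤ (y ^ n * v) ^ (n ℕ.+ 3)
    C^n≤ = begin
      C ^ n                   ≡⟨ ℚ.*-identityʳ (C ^ n) ⟨
      C ^ n * 1ℚ              ≤⟨ *-monoˡ-≤ (0≤^ 0≤C n) (1≤^ 1≤C 3) ⟩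
      C ^ n * C ^ 3           ≡⟨ ^-homo-* C n 3 ⟨
      C ^ (n ℕ.+ 3)           ≤⟨ ^-monoˡ-≤ (n ℕ.+ 3) 0≤C (c≤y^n*n k 0≤C 0≤y h) ⟩
      (y ^ n * v) ^ (n ℕ.+ 3) ∎
    exponents : suc n ℕ.* suc n ℕ.≤ n ℕ.* (n ℕ.+ 3)
    exponents = ℕ.≤-trans (ℕ.m≤m+n (suc n ℕ.* suc n) k) (ℕ.≤-reflexive (lemma k))
      where
      lemma : ∀ k → suc (suc k) ℕ.* suc (suc k) ℕ.+ k ≡ suc k ℕ.* (suc k ℕ.+ 3)
      lemma = solve-∀

  -- Since (1-t)(1+t) ≤ 1 and n ≤ (1+t)^n, one has (1-t)^n * n ≤ 1. After multiplication by n, the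
  -- bound 2 n^(n-2) for n! contains n - 1 factors of n, exactly one for each of the n - 1 blocks
  -- (1-t)^n in (1-t)^(n(n-1)).
  upper-regime : ∀ l {t Q} → let k = suc l; n = suc k in
    0ℚ ≤ t → t ≤ 1ℚ → H k + 1ℚ ≤ ι n * t →
    Q ≤ ι (n !) * (1ℚ - t) ^ (n ℕ.* k) → Q * ι n ≤ 2ℚ
  upper-regime l {t} {Q} 0≤t t≤1 h Q≤ = begin
    Q * v                                ≤⟨ *-monoʳ-≤ (0≤ι n) Q≤ ⟩
    ι (n !) * y ^ (n ℕ.* k) * v          ≤⟨ *-monoʳ-≤ (0≤ι n) (*-monoʳ-≤ (0≤^ 0≤y (n ℕ.* k)) n!≤) ⟩
    2ℚ * v ^ l * y ^ (n ℕ.* k) * v       ≡⟨ solve 4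
      (λ a p q v → a :* p :* q :* v := a :* (q :* (v :* p))) refl 2ℚ (v ^ l) (y ^ (n ℕ.* k)) v ⟩
    2ℚ * (y ^ (n ℕ.* k) * v ^ k)         ≡⟨ cong (λ z → 2ℚ * (z * v ^ k)) (^-assocʳ y n k) ⟨
    2ℚ * ((y ^ n) ^ k * v ^ k)           ≡⟨ cong (2ℚ *_) (^-distrib-* (y ^ n) v k) ⟨
    2ℚ * (y ^ n * v) ^ k                 ≤⟨ *-monoˡ-≤ (0≤ι 2)
      (^-monoˡ-≤ k (0≤* (0≤^ 0≤y n) (0≤ι n)) y^n*n≤1) ⟩
    2ℚ * 1ℚ ^ k                          ≡⟨ cong (2ℚ *_) (1^ k) ⟩
    2ℚ * 1ℚ                              ≡⟨ ℚ.*-identityʳ 2ℚ ⟩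
    2ℚ                                   ∎
    where
    open ℚ.≤-Reasoning
    k = suc l
    n = suc k
    v = ι n
    y = 1ℚ - t
    0≤y : 0ℚ ≤ y
    0≤y = ≤⇒diff t≤1
    n!≤ : ι (n !) ≤ 2ℚ * v ^ l
    n!≤ = ℚ.≤-trans (ι-mono ([2+l]!≤2m^l l ℕ.≤-refl))
      (ℚ.≤-reflexive (trans (ι-* 2 (n ℕ.^ l)) (cong (2ℚ *_) (ι-^ n l))))
    y^n*n≤1 : y ^ n * v ≤ 1ℚ
    y^n*n≤1 = begin
      y ^ n * v                 ≤⟨ *-monoˡ-≤ (0≤^ 0≤y n) (n≤[1+t]^n k 0≤t h) ⟩
      y ^ n * (1ℚ + t) ^ n      ≡⟨ ^-distrib-* y (1ℚ + t) n ⟨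
      (y * (1ℚ + t)) ^ n        ≤⟨ ^-monoˡ-≤ n {y * (1ℚ + t)} {1ℚ} (0≤* 0≤y (0≤+ 0≤1 0≤t))
        (diff⇒≤ {y * (1ℚ + t)} {1ℚ} (subst (0ℚ ≤_)
                                    (solve 1 (λ t → t :* t :=
                                      con 1ℚ :- (con 1ℚ :- t) :* (con 1ℚ :+ t)) refl t) (0≤² t))) ⟩
      1ℚ ^ n                    ≡⟨ 1^ n ⟩
      1ℚ                        ∎

open HarmonicEstimates

-- Finite sums and expectations over random sublists.

module RandomSubsets where
  open import Data.Rational.Base using (_≤_; _<_; _+_; _*_; _-_; -_; ∣_∣)
  open +-*-Solver using (solve; _:+_; _:*_; _:-_; :-_; _:=_; con)

  private
    variable
      X Y : Set

  ∑ ∏ : List X → (X → ℚ) → ℚ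
  ∑ []       f = 0ℚ
  ∑ (x ∷ xs) f = f x + ∑ xs f
  ∏ []       f = 1ℚ
  ∏ (x ∷ xs) f = f x * ∏ xs f

  ∑-cong : ∀ (xs : List X) {f g} → (∀ x → f x ≡ g x) → ∑ xs f ≡ ∑ xs g
  ∑-cong []       e = refl
  ∑-cong (x ∷ xs) e = cong₂ _+_ (e x) (∑-cong xs e)

  ∑-mono : ∀ (xs : List X) {f g} → (∀ {x} → x ∈ xs → f x ≤ g x) → ∑ xs f ≤ ∑ xs g
  ∑-mono []       h = ℚ.≤-refl
  ∑-mono (x ∷ xs) h = ℚ.+-mono-≤ (h (here refl)) (∑-mono xs (h ∘ there))

  ∑-nonneg : ∀ (xs : List X) {f} → (∀ x → 0ℚ ≤ f x) → 0ℚ ≤ ∑ xs f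
  ∑-nonneg []       h = ℚ.≤-refl
  ∑-nonneg (x ∷ xs) h = 0≤+ (h x) (∑-nonneg xs h)

  ∑-+ : ∀ (xs : List X) f g → ∑ xs (λ x → f x + g x) ≡ ∑ xs f + ∑ xs g
  ∑-+ []       f g = refl
  ∑-+ (x ∷ xs) f g = trans (cong (f x + g x +_) (∑-+ xs f g))
    (solve 4 (λ a b c d → a :+ b :+ (c :+ d) := a :+ c :+ (b :+ d)) refl (f x) (g x) (∑ xs f)
      (∑ xs g))

  ∑-*ˡ : ∀ (xs : List X) c f → ∑ xs (λ x → c * f x) ≡ c * ∑ xs f
  ∑-*ˡ []       c f = sym (ℚ.*-zeroʳ c)
  ∑-*ˡ (x ∷ xs) c f = trans (cong (c * f x +_) (∑-*ˡ xs c f))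
    (sym (ℚ.*-distribˡ-+ c (f x) (∑ xs f)))

  ∑-*ʳ : ∀ (xs : List X) c f → ∑ xs (λ x → f x * c) ≡ ∑ xs f * c
  ∑-*ʳ xs c f = trans (∑-cong xs λ x → ℚ.*-comm (f x) c) (trans (∑-*ˡ xs c f) (ℚ.*-comm c (∑ xs f)))

  ∑-0 : ∀ (xs : List X) → ∑ xs (λ _ → 0ℚ) ≡ 0ℚ
  ∑-0 []       = refl
  ∑-0 (x ∷ xs) = trans (ℚ.+-identityˡ _) (∑-0 xs)

  ∑-swap : ∀ (xs : List X) (ys : List Y) (f : X → Y → ℚ) →
    ∑ xs (λ x → ∑ ys (f x)) ≡ ∑ ys (λ y → ∑ xs (λ x → f x y))
  ∑-swap []       ys f = sym (∑-0 ys)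
  ∑-swap (x ∷ xs) ys f = trans (cong (∑ ys (f x) +_) (∑-swap xs ys f)) (sym (∑-+ ys (f x) _))

  ∑-const : ∀ (xs : List X) c → ∑ xs (λ _ → c) ≡ ι (length xs) * c
  ∑-const []       c = sym (ℚ.*-zeroˡ c)
  ∑-const (x ∷ xs) c = trans (cong (c +_) (∑-const xs c))
    (solve 2 (λ c l → c :+ l :* c := (con 1ℚ :+ l) :* c) refl c (ι (length xs)))

  ∑-++ : ∀ (xs ys : List X) f → ∑ (xs ++ ys) f ≡ ∑ xs f + ∑ ys f
  ∑-++ []       ys f = sym (ℚ.+-identityˡ _)
  ∑-++ (x ∷ xs) ys f = trans (cong (f x +_) (∑-++ xs ys f))
    (sym (ℚ.+-assoc (f x) (∑ xs f) (∑ ys f)))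

  ∑-map : ∀ (xs : List X) (h : X → Y) f → ∑ (List.map h xs) f ≡ ∑ xs (f ∘ h)
  ∑-map []       h f = refl
  ∑-map (x ∷ xs) h f = cong (f (h x) +_) (∑-map xs h f)

  ∏-nonneg : ∀ (xs : List X) {f} → (∀ x → 0ℚ ≤ f x) → 0ℚ ≤ ∏ xs f
  ∏-nonneg []       h = 0≤1
  ∏-nonneg (x ∷ xs) h = 0≤* (h x) (∏-nonneg xs h)

  ∏-mono : ∀ (xs : List X) {f g} → (∀ x → 0ℚ ≤ f x) → (∀ x → f x ≤ g x) → ∏ xs f ≤ ∏ xs g
  ∏-mono []       0≤f f≤g = ℚ.≤-refl
  ∏-mono (x ∷ xs) 0≤f f≤g = *-mono-≤ (0≤f x) (f≤g x)
    (∏-nonneg xs λ x → ℚ.≤-trans (0≤f x) (f≤g x)) (∏-mono xs 0≤f f≤g)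

  ∏-* : ∀ (xs : List X) f g → ∏ xs (λ x → f x * g x) ≡ ∏ xs f * ∏ xs g
  ∏-* []       f g = refl
  ∏-* (x ∷ xs) f g = trans (cong (f x * g x *_) (∏-* xs f g))
    (solve 4 (λ a b c d → a :* b :* (c :* d) := a :* c :* (b :* d)) refl (f x) (g x) (∏ xs f)
      (∏ xs g))

  𝟙 : ∀ {P : Set} → Dec P → ℚ
  𝟙 (yes _) = 1ℚ
  𝟙 (no  _) = 0ℚ

  0≤𝟙 : ∀ {P : Set} (d : Dec P) → 0ℚ ≤ 𝟙 d
  0≤𝟙 (yes _) = 0≤1
  0≤𝟙 (no  _) = ℚ.≤-refl

  𝟙≤1 : ∀ {P : Set} (d : Dec P) → 𝟙 d ≤ 1ℚ
  𝟙≤1 (yes _) = ℚ.≤-refl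
  𝟙≤1 (no  _) = 0≤1

  count : ∀ {P : Pred X 0ℓ} → Decidable P → List X → ℕ
  count P? xs = length (filter P? xs)

  ∑-𝟙 : ∀ {P : Pred X 0ℓ} (P? : Decidable P) xs → ∑ xs (𝟙 ∘ P?) ≡ ι (count P? xs)
  ∑-𝟙 P? [] = refl
  ∑-𝟙 P? (x ∷ xs) with P? x
  ... | yes _ = cong (1ℚ +_) (∑-𝟙 P? xs)
  ... | no  _ = trans (ℚ.+-identityˡ _) (∑-𝟙 P? xs)

  -- Expectation of f over a random sublist of xs that keeps each entry independently
  -- with probability t.
  𝔼 : ℚ → List X → (List X → ℚ) → ℚ
  𝔼 t []       f = f []
  𝔼 t (x ∷ xs) f = t * 𝔼 t xs (f ∘ (x ∷_)) + (1ℚ - t) * 𝔼 t xs f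

  𝔼-cong : ∀ t (xs : List X) {f g} → (∀ A → f A ≡ g A) → 𝔼 t xs f ≡ 𝔼 t xs g
  𝔼-cong t []       e = e []
  𝔼-cong t (x ∷ xs) e = cong₂ (λ a b → t * a + (1ℚ - t) * b) (𝔼-cong t xs (e ∘ (x ∷_)))
    (𝔼-cong t xs e)

  𝔼-+ : ∀ t (xs : List X) f g → 𝔼 t xs (λ A → f A + g A) ≡ 𝔼 t xs f + 𝔼 t xs g
  𝔼-+ t []       f g = refl
  𝔼-+ t (x ∷ xs) f g = trans
    (cong₂ (λ a b → t * a + (1ℚ - t) * b) (𝔼-+ t xs (f ∘ (x ∷_)) (g ∘ (x ∷_))) (𝔼-+ t xs f g))
    (solve 6 (λ t s a b c d → t :* (a :+ b) :+ s :* (c :+ d) :=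
      t :* a :+ s :* c :+ (t :* b :+ s :* d)) refl
      t (1ℚ - t) (𝔼 t xs (f ∘ (x ∷_))) (𝔼 t xs (g ∘ (x ∷_))) (𝔼 t xs f) (𝔼 t xs g))

  𝔼-*ˡ : ∀ t (xs : List X) c f → 𝔼 t xs (λ A → c * f A) ≡ c * 𝔼 t xs f
  𝔼-*ˡ t []       c f = refl
  𝔼-*ˡ t (x ∷ xs) c f = trans
    (cong₂ (λ a b → t * a + (1ℚ - t) * b) (𝔼-*ˡ t xs c (f ∘ (x ∷_))) (𝔼-*ˡ t xs c f))
    (solve 5 (λ t s c a b → t :* (c :* a) :+ s :* (c :* b) := c :* (t :* a :+ s :* b)) refl
      t (1ℚ - t) c (𝔼 t xs (f ∘ (x ∷_))) (𝔼 t xs f))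

  𝔼-const : ∀ t (xs : List X) c → 𝔼 t xs (λ _ → c) ≡ c
  𝔼-const t []       c = refl
  𝔼-const t (x ∷ xs) c = trans (cong₂ (λ a b → t * a + (1ℚ - t) * b) (𝔼-const t xs c)
    (𝔼-const t xs c))
    (solve 2 (λ t c → t :* c :+ (con 1ℚ :- t) :* c := c) refl t c)

  𝔼-∑ : ∀ t (xs : List X) (ys : List Y) (f : Y → List X → ℚ) →
    𝔼 t xs (λ A → ∑ ys (λ y → f y A)) ≡ ∑ ys (λ y → 𝔼 t xs (f y))
  𝔼-∑ t xs []       f = 𝔼-const t xs 0ℚ
  𝔼-∑ t xs (y ∷ ys) f = trans (𝔼-+ t xs (f y) _) (cong (𝔼 t xs (f y) +_) (𝔼-∑ t xs ys f))

  -- Independence enters here: each entry contributes its own factor, `g x` if it is kept and 1 if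
  -- it is dropped.
  𝔼-∏ : ∀ t (xs : List X) g → 𝔼 t xs (λ A → ∏ A g) ≡ ∏ xs (λ x → t * g x + (1ℚ - t))
  𝔼-∏ t []       g = refl
  𝔼-∏ t (x ∷ xs) g = trans
    (cong (λ z → t * z + (1ℚ - t) * 𝔼 t xs (λ A → ∏ A g)) (𝔼-*ˡ t xs (g x) (λ A → ∏ A g)))
    (trans (solve 4 (λ t s a z → t :* (a :* z) :+ s :* z := (t :* a :+ s) :* z) refl
              t (1ℚ - t) (g x) (𝔼 t xs (λ A → ∏ A g)))
      (cong ((t * g x + (1ℚ - t)) *_) (𝔼-∏ t xs g)))

  𝔼-mono : ∀ {t} → 0ℚ ≤ t → t ≤ 1ℚ → ∀ (xs : List X) {f g} → (∀ A → f A ≤ g A) → 𝔼 t xs f ≤ 𝔼 t xs g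
  𝔼-mono 0≤t t≤1 []       h = h []
  𝔼-mono 0≤t t≤1 (x ∷ xs) h = ℚ.+-mono-≤
    (*-monoˡ-≤ 0≤t (𝔼-mono 0≤t t≤1 xs (h ∘ (x ∷_))))
    (*-monoˡ-≤ (≤⇒diff t≤1) (𝔼-mono 0≤t t≤1 xs h))

  seq-sumℝ : ∀ (l : List X) f m → seq (sumℝ (List.map f l)) m ≡ ∑ l (λ x → seq (f x) m)
  seq-sumℝ []      f m = refl
  seq-sumℝ (x ∷ l) f m = cong (seq (f x) m +_) (seq-sumℝ l f m)

  seq-^ : ∀ p k m → seq (p Defs.^ k) m ≡ seq p m ^ k
  seq-^ p zero    m = refl
  seq-^ p (suc k) m = cong (seq p m *_) (seq-^ p k m)

  ∑-filter : ∀ {P : Pred X 0ℓ} (P? : Decidable P) xs f → ∑ (filter P? xs) f ≡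
    ∑ xs (λ x → 𝟙 (P? x) * f x)
  ∑-filter P? []       f = refl
  ∑-filter P? (x ∷ xs) f with P? x
  ... | yes _ = cong₂ _+_ (sym (ℚ.*-identityˡ (f x))) (∑-filter P? xs f)
  ... | no  _ = trans (∑-filter P? xs f) (sym
    (trans (cong (_+ _) (ℚ.*-zeroˡ (f x))) (ℚ.+-identityˡ _)))

  ∑-cong-All : ∀ {xs : List X} {P : Pred X 0ℓ} {f g} → ListAll.All P xs →
    (∀ {x} → P x → f x ≡ g x) → ∑ xs f ≡ ∑ xs g
  ∑-cong-All ListAll.[]       e = refl
  ∑-cong-All (px ListAll.∷ pxs) e = cong₂ _+_ (e px) (∑-cong-All pxs e)

  -- Makes the truncated subtraction in the weight exact, so that a dropped entry contributes
  -- precisely one more factor 1 - t.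
  subsets-length : ∀ (xs : List X) → ListAll.All (λ A → length A ℕ.≤ length xs) (subsets xs)
  subsets-length []       = ℕ.≤-refl ListAll.∷ ListAll.[]
  subsets-length (x ∷ xs) = ListAll.++⁺ (ListAll.map⁺ (ListAll.map ℕ.s≤s (subsets-length xs)))
                                    (ListAll.map ℕ.m≤n⇒m≤1+n (subsets-length xs))

  weightℚ : ℚ → ℕ → List X → ℚ
  weightℚ t N A = t ^ length A * (1ℚ - t) ^ (N ℕ.∸ length A)

  ∑-subsets : ∀ t (xs : List X) f → ∑ (subsets xs) (λ A → f A * weightℚ t (length xs) A) ≡ 𝔼 t xs f
  ∑-subsets t []       f = solve 1 (λ a → a :* (con 1ℚ :* con 1ℚ) :+ con 0ℚ := a) refl (f [])
  ∑-subsets t (x ∷ xs) f = begin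
    ∑ (List.map (x ∷_) (subsets xs) ++ subsets xs) F
      ≡⟨ ∑-++ (List.map (x ∷_) (subsets xs)) (subsets xs) F ⟩
    ∑ (List.map (x ∷_) (subsets xs)) F + ∑ (subsets xs) F
      ≡⟨ cong₂ _+_ picked dropped ⟩
    t * 𝔼 t xs (f ∘ (x ∷_)) + (1ℚ - t) * 𝔼 t xs f ∎
    where
    open ≡-Reasoning
    F = λ A → f A * weightℚ t (suc (length xs)) A
    picked : ∑ (List.map (x ∷_) (subsets xs)) F ≡ t * 𝔼 t xs (f ∘ (x ∷_))
    picked = trans (∑-map (subsets xs) (x ∷_) F)
      (trans (∑-cong (subsets xs) λ A → solve 4
        (λ a t p q → a :* (t :* p :* q) := t :* (a :* (p :* q))) refl
          (f (x ∷ A)) t (t ^ length A) ((1ℚ - t) ^ (length xs ℕ.∸ length A)))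
      (trans (∑-*ˡ (subsets xs) t _) (cong (t *_) (∑-subsets t xs (f ∘ (x ∷_))))))
    dropped : ∑ (subsets xs) F ≡ (1ℚ - t) * 𝔼 t xs f
    dropped = trans (∑-cong-All (subsets-length xs) λ {A} A≤ → trans
        (cong (λ k → f A * (t ^ length A * (1ℚ - t) ^ k)) (ℕ.+-∸-assoc 1 A≤))
        (solve 4 (λ a s p q → a :* (p :* (s :* q)) := s :* (a :* (p :* q))) refl
          (f A) (1ℚ - t) (t ^ length A) ((1ℚ - t) ^ (length xs ℕ.∸ length A))))
      (trans (∑-*ˡ (subsets xs) (1ℚ - t) _) (cong ((1ℚ - t) *_) (∑-subsets t xs f)))

  seq-ℙ : ∀ {P : Pred (List X) 0ℓ} p (xs : List X) (P? : Decidable P) m →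
    seq (ℙ p xs P?) m ≡ 𝔼 (seq p m) xs (𝟙 ∘ P?)
  seq-ℙ p xs P? m = begin
    seq (ℙ p xs P?) m
      ≡⟨ seq-sumℝ (filter P? (subsets xs)) (weight p (length xs)) m ⟩
    ∑ (filter P? (subsets xs)) (λ A → seq (weight p (length xs) A) m)
      ≡⟨ ∑-cong (filter P? (subsets xs)) (λ A →
        cong₂ _*_ (seq-^ p (length A) m) (seq-^ (1ℝ Defs.- p) (length xs ℕ.∸ length A) m)) ⟩
    ∑ (filter P? (subsets xs)) (weightℚ (seq p m) (length xs))
      ≡⟨ ∑-filter P? (subsets xs) _ ⟩
    ∑ (subsets xs) (λ A → 𝟙 (P? A) * weightℚ (seq p m) (length xs) A)
      ≡⟨ ∑-subsets (seq p m) xs (𝟙 ∘ P?) ⟩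
    𝔼 (seq p m) xs (𝟙 ∘ P?) ∎
    where open ≡-Reasoning

  -- First and second moment of the number of uncovered elements, for any decidable relation.

  module Covering {X Y : Set} {R : X → Y → Set} (R? : ∀ x y → Dec (R x y))
    (xs : List X) (ys : List Y) {t : ℚ} (0≤t : 0ℚ ≤ t) (t≤1 : t ≤ 1ℚ) where

    Covers : Pred (List X) 0ℓ
    Covers A = ListAll.All (λ y → Any (λ x → R x y) A) ys

    c : X → Y → ℚ
    c x y = 𝟙 (R? x y)

    -- The 0-1 indicator that no entry of `A` is related to `y`. As a product over `A` it has its
    -- expectation computed by `𝔼-∏`, and so has the product of two such indicators.
    uncovered : Y → List X → ℚ
    uncovered y A = ∏ A (λ x → 1ℚ - c x y)

    degree : Y → ℕ
    degree y = count (λ x → R? x y) xs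

    0≤1-c : ∀ x y → 0ℚ ≤ 1ℚ - c x y
    0≤1-c x y = ≤⇒diff (𝟙≤1 (R? x y))

    0≤1-t : 0ℚ ≤ 1ℚ - t
    0≤1-t = ≤⇒diff t≤1

    0≤uncovered : ∀ y A → 0ℚ ≤ uncovered y A
    0≤uncovered y A = ∏-nonneg A (λ x → 0≤1-c x y)

    covered⇒0 : ∀ {y A} → Any (λ x → R x y) A → uncovered y A ≡ 0ℚ
    covered⇒0 {y} {x ∷ A} (here r) with R? x y
    ... | yes _ = ℚ.*-zeroˡ (uncovered y A)
    ... | no ¬r = ⊥-elim (¬r r)
    covered⇒0 {y} {x ∷ A} (there a) =
      trans (cong ((1ℚ - c x y) *_) (covered⇒0 a)) (ℚ.*-zeroʳ (1ℚ - c x y))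

    ¬covered⇒1 : ∀ {y} A → ¬ Any (λ x → R x y) A → uncovered y A ≡ 1ℚ
    ¬covered⇒1     []      ¬a = refl
    ¬covered⇒1 {y} (x ∷ A) ¬a with R? x y
    ... | yes r = ⊥-elim (¬a (here r))
    ... | no  _ = trans (ℚ.*-identityˡ _) (¬covered⇒1 A (¬a ∘ there))

    #uncovered : List X → ℚ
    #uncovered A = ∑ ys (λ y → uncovered y A)

    0≤#uncovered : ∀ A → 0ℚ ≤ #uncovered A
    0≤#uncovered A = ∑-nonneg ys (λ y → 0≤uncovered y A)

    covers⇒0 : ∀ {A} → Covers A → #uncovered A ≡ 0ℚ
    covers⇒0 all = trans (∑-cong-All all covered⇒0) (∑-0 ys)

    ¬covers⇒1≤ : ∀ {A} → ¬ Covers A → 1ℚ ≤ #uncovered A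
    ¬covers⇒1≤ {A} ¬all = go (ListAll.¬All⇒Any¬ (λ y → any? (λ x → R? x y) A) ys ¬all)
      where
      go : ∀ {ys} → Any (λ y → ¬ Any (λ x → R x y) A) ys → 1ℚ ≤ ∑ ys (λ y → uncovered y A)
      go {y ∷ ys} (here ¬a) = subst (_≤ uncovered y A + ∑ ys (λ y → uncovered y A))
        (ℚ.+-identityʳ 1ℚ) (ℚ.+-mono-≤
        (ℚ.≤-reflexive (sym (¬covered⇒1 A ¬a))) (∑-nonneg ys (λ y → 0≤uncovered y A)))
      go {y ∷ ys} (there h) = subst (_≤ uncovered y A + ∑ ys (λ y → uncovered y A))
        (ℚ.+-identityˡ 1ℚ)
        (ℚ.+-mono-≤ (0≤uncovered y A) (go h))

    e : Y → ℚ
    e y = 𝔼 t xs (uncovered y)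

    factor : Y → X → ℚ
    factor y x = t * (1ℚ - c x y) + (1ℚ - t)

    e≡∏ : ∀ y → e y ≡ ∏ xs (factor y)
    e≡∏ y = 𝔼-∏ t xs (λ x → 1ℚ - c x y)

    e≡^ : ∀ y → e y ≡ (1ℚ - t) ^ degree y
    e≡^ y = trans (e≡∏ y) (go xs)
      where
      go : ∀ xs → ∏ xs (factor y) ≡ (1ℚ - t) ^ count (λ x → R? x y) xs
      go [] = refl
      go (x ∷ xs) with R? x y
      ... | yes _ = cong₂ _*_ (solve 1 (λ t → t :* (con 1ℚ :- con 1ℚ) :+ (con 1ℚ :- t) :=
        con 1ℚ :- t) refl t) (go xs)
      ... | no  _ =
        trans (cong₂ _*_ (solve 1 (λ t → t :* (con 1ℚ :- con 0ℚ) :+ (con 1ℚ :- t) := con 1ℚ) refl t)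
        (go xs)) (ℚ.*-identityˡ _)

    0≤e : ∀ y → 0ℚ ≤ e y
    0≤e y = subst (0ℚ ≤_) (sym (e≡^ y)) (0≤^ 0≤1-t (degree y))

    joint : Y → Y → ℚ
    joint y y′ = 𝔼 t xs (λ A → uncovered y A * uncovered y′ A)

    common : Y → Y → ℚ
    common y y′ = ∑ xs (λ x → c x y * c x y′)

    -- The events are independent unless some x covers both y and y′, in which case
    -- common y y′ ≥ 1 and the second summand alone suffices.
    joint≤ : ∀ y y′ → joint y y′ ≤ e y * e y′ + e y * common y y′
    joint≤ y y′ = subst₂ _≤_
      (sym (trans (𝔼-cong t xs λ A → sym (∏-* A (λ x → 1ℚ - c x y) (λ x → 1ℚ - c x y′)))
                  (𝔼-∏ t xs (λ x → (1ℚ - c x y) * (1ℚ - c x y′)))))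
      (cong₂ (λ a b → a * b + a * common y y′) (sym (e≡∏ y)) (sym (e≡∏ y′)))
      (go xs)
      where
      open ℚ.≤-Reasoning
      both : X → ℚ
      both x = t * ((1ℚ - c x y) * (1ℚ - c x y′)) + (1ℚ - t)
      0≤factor : ∀ y x → 0ℚ ≤ factor y x
      0≤factor y x = 0≤+ (0≤* 0≤t (0≤1-c x y)) 0≤1-t
      0≤both : ∀ x → 0ℚ ≤ both x
      0≤both x = 0≤+ (0≤* 0≤t (0≤* (0≤1-c x y) (0≤1-c x y′))) 0≤1-t
      factor≤1 : ∀ y x → factor y x ≤ 1ℚ
      factor≤1 y x = diff⇒≤ (subst (0ℚ ≤_)
        (solve 2 (λ t c → t :* c := con 1ℚ :- (t :* (con 1ℚ :- c) :+ (con 1ℚ :- t))) refl t (c x y))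
        (0≤* 0≤t (0≤𝟙 (R? x y))))
      both≤factor : ∀ x → both x ≤ factor y x
      both≤factor x = diff⇒≤ (subst (0ℚ ≤_)
        (solve 3 (λ t c d → t :* (c :* d) := t :* c :+ (con 1ℚ :- t) :-
          (t :* (c :* (con 1ℚ :- d)) :+ (con 1ℚ :- t))) refl t (1ℚ - c x y) (c x y′))
        (0≤* 0≤t (0≤* (0≤1-c x y) (0≤𝟙 (R? x y′)))))
      -- The induction step for one more entry x; `G`, `A`, `B`, `S` are the joint product, the two
      -- single products and the common count over the tail. If x is related to both elements, the
      -- joint factor 1 - t equals the factor of the first alone, so G ≤ A suffices and the new 1 in
      -- the common count pays for it. Otherwise the joint factor is the product of the two single
      -- ones, and the induction hypothesis is multiplied by it.
      dichotomy : ∀ {P Q : Set} (d : Dec P) (d′ : Dec Q) → let a = 𝟙 d; b = 𝟙 d′ in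
        ∀ {G A B S} → G ≤ A → 0ℚ ≤ A → 0ℚ ≤ B → 0ℚ ≤ S →
        0ℚ ≤ t * (1ℚ - a) + (1ℚ - t) → 0ℚ ≤ t * (1ℚ - b) + (1ℚ - t) → t * (1ℚ - b) + (1ℚ - t) ≤ 1ℚ →
        G ≤ A * B + A * S →
        (t * ((1ℚ - a) * (1ℚ - b)) + (1ℚ - t)) * G ≤
          (t * (1ℚ - a) + (1ℚ - t)) * A * ((t * (1ℚ - b) + (1ℚ - t)) * B)
          + (t * (1ℚ - a) + (1ℚ - t)) * A * (a * b + S)
      dichotomy (yes _) (yes _) {G} {A} {B} {S} G≤A 0≤A 0≤B 0≤S _ 0≤fb _ _ = begin
        (t * ((1ℚ - 1ℚ) * (1ℚ - 1ℚ)) + (1ℚ - t)) * G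
          ≡⟨ solve 2 (λ t G → (t :* ((con 1ℚ :- con 1ℚ) :* (con 1ℚ :- con 1ℚ)) :+ (con 1ℚ :- t)) :*
            G := (con 1ℚ :- t) :* G) refl t G ⟩
        (1ℚ - t) * G  ≤⟨ *-monoˡ-≤ 0≤1-t G≤A ⟩
        (1ℚ - t) * A  ≤⟨ diff⇒≤ (subst (0ℚ ≤_)
            (solve 5 (λ t A B S f → (con 1ℚ :- t) :* A :* (f :* B :+ S) :=
               (t :* (con 1ℚ :- con 1ℚ) :+ (con 1ℚ :- t)) :* A :* (f :* B)
               :+ (t :* (con 1ℚ :- con 1ℚ) :+ (con 1ℚ :- t)) :* A :* (con 1ℚ :* con 1ℚ :+ S)
               :- (con 1ℚ :- t) :* A) refl t A B S (t * (1ℚ - 1ℚ) + (1ℚ - t)))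
            (0≤* (0≤* 0≤1-t 0≤A) (0≤+ (0≤* 0≤fb 0≤B) 0≤S))) ⟩
        (t * (1ℚ - 1ℚ) + (1ℚ - t)) * A * ((t * (1ℚ - 1ℚ) + (1ℚ - t)) * B)
          + (t * (1ℚ - 1ℚ) + (1ℚ - t)) * A * (1ℚ * 1ℚ + S) ∎
      dichotomy (yes _) (no _) {G} {A} {B} {S} G≤A 0≤A 0≤B 0≤S 0≤fa _ _ h = begin
        (t * ((1ℚ - 1ℚ) * (1ℚ - 0ℚ)) + (1ℚ - t)) * G
          ≡⟨ solve 2 (λ t G → (t :* ((con 1ℚ :- con 1ℚ) :* (con 1ℚ :- con 0ℚ)) :+ (con 1ℚ :- t)) :*
            G := (t :* (con 1ℚ :- con 1ℚ) :+ (con 1ℚ :- t)) :* G) refl t G ⟩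
        (t * (1ℚ - 1ℚ) + (1ℚ - t)) * G                ≤⟨ *-monoˡ-≤ 0≤fa h ⟩
        (t * (1ℚ - 1ℚ) + (1ℚ - t)) * (A * B + A * S)
          ≡⟨ solve 5 (λ t A B S f → f :* (A :* B :+ A :* S) :=
            f :* A :* ((t :* (con 1ℚ :- con 0ℚ) :+ (con 1ℚ :- t)) :* B) :+ f :* A :*
            (con 1ℚ :* con 0ℚ :+ S)) refl t A B S (t * (1ℚ - 1ℚ) + (1ℚ - t)) ⟩
        (t * (1ℚ - 1ℚ) + (1ℚ - t)) * A * ((t * (1ℚ - 0ℚ) + (1ℚ - t)) * B)
          + (t * (1ℚ - 1ℚ) + (1ℚ - t)) * A * (1ℚ * 0ℚ + S) ∎
      dichotomy (no _) d′ {G} {A} {B} {S} G≤A 0≤A 0≤B 0≤S _ 0≤fb fb≤1 h =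
        let b = 𝟙 d′
            f = t * (1ℚ - b) + (1ℚ - t)
        in begin
        (t * ((1ℚ - 0ℚ) * (1ℚ - b)) + (1ℚ - t)) * G
          ≡⟨ solve 3 (λ t b G → (t :* ((con 1ℚ :- con 0ℚ) :* (con 1ℚ :- b)) :+ (con 1ℚ :- t)) :* G
            := (t :* (con 1ℚ :- b) :+ (con 1ℚ :- t)) :* G) refl t b G ⟩
        f * G                          ≤⟨ *-monoˡ-≤ 0≤fb h ⟩
        f * (A * B + A * S)            ≡⟨ solve 4
          (λ f A B S → f :* (A :* B :+ A :* S) := f :* A :* B :+ f :* (A :* S)) refl f A B S ⟩
        f * A * B + f * (A * S)        ≤⟨ ℚ.+-monoʳ-≤ (f * A * B) (*-monoʳ-≤ (0≤* 0≤A 0≤S) fb≤1) ⟩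
        f * A * B + 1ℚ * (A * S)
          ≡⟨ solve 6 (λ t b f A B S → f :* A :* B :+ con 1ℚ :* (A :* S) :=
            (t :* (con 1ℚ :- con 0ℚ) :+ (con 1ℚ :- t)) :* A :* (f :* B) :+
            (t :* (con 1ℚ :- con 0ℚ) :+ (con 1ℚ :- t)) :* A :* (con 0ℚ :* b :+ S)) refl t b f A B
            S ⟩
        (t * (1ℚ - 0ℚ) + (1ℚ - t)) * A * (f * B)
          + (t * (1ℚ - 0ℚ) + (1ℚ - t)) * A * (0ℚ * b + S) ∎
      go : ∀ xs → ∏ xs both ≤ ∏ xs (factor y) * ∏ xs (factor y′) + ∏ xs (factor y) * ∑ xs
        (λ x → c x y * c x y′)
      go []       = ℚ.≤ᵇ⇒≤ _
      go (x ∷ xs) = dichotomy (R? x y) (R? x y′)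
        (∏-mono xs 0≤both both≤factor) (∏-nonneg xs (0≤factor y))
        (∏-nonneg xs (0≤factor y′)) (∑-nonneg xs λ x → 0≤* (0≤𝟙 (R? x y)) (0≤𝟙 (R? x y′)))
        (0≤factor y x) (0≤factor y′ x) (factor≤1 y′ x) (go xs)

    μ : ℚ
    μ = ∑ ys e

    𝔼#uncovered : 𝔼 t xs #uncovered ≡ μ
    𝔼#uncovered = 𝔼-∑ t xs ys uncovered

    -- The inner sum over y′ includes y itself, so `D` also absorbs the diagonal of the second
    -- moment.
    second-moment≤ : ∀ {D} → (∀ y → y ∈ ys → ∑ ys (common y) ≤ D) →
      𝔼 t xs (λ A → #uncovered A * #uncovered A) ≤ μ * μ + μ * D
    second-moment≤ {D} h = begin
      𝔼 t xs (λ A → #uncovered A * #uncovered A)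
        ≡⟨ 𝔼-cong t xs (λ A → trans (sym (∑-*ʳ ys (#uncovered A) _))
          (∑-cong ys λ y → sym (∑-*ˡ ys (uncovered y A) _))) ⟩
      𝔼 t xs (λ A → ∑ ys (λ y → ∑ ys (λ y′ → uncovered y A * uncovered y′ A)))
        ≡⟨ trans (𝔼-∑ t xs ys _) (∑-cong ys λ y → 𝔼-∑ t xs ys _) ⟩
      ∑ ys (λ y → ∑ ys (joint y))
        ≤⟨ ∑-mono ys (λ {y} y∈ → ∑-mono ys λ {y′} _ → joint≤ y y′) ⟩
      ∑ ys (λ y → ∑ ys (λ y′ → e y * e y′ + e y * common y y′))
        ≡⟨ ∑-cong ys (λ y → trans (∑-+ ys _ _)
          (cong₂ _+_ (∑-*ˡ ys (e y) e) (∑-*ˡ ys (e y) (common y)))) ⟩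
      ∑ ys (λ y → e y * μ + e y * ∑ ys (common y))
        ≤⟨ ∑-mono ys (λ {y} y∈ → ℚ.+-monoʳ-≤ (e y * μ) (*-monoˡ-≤ (0≤e y) (h y y∈))) ⟩
      ∑ ys (λ y → e y * μ + e y * D)
        ≡⟨ trans (∑-+ ys _ _) (cong₂ _+_ (∑-*ʳ ys μ e) (∑-*ʳ ys D e)) ⟩
      μ * μ + μ * D ∎
      where open ℚ.≤-Reasoning

    module _ (covers? : Decidable Covers) where

      P : ℚ
      P = 𝔼 t xs (𝟙 ∘ covers?)

      0≤P : 0ℚ ≤ P
      0≤P = subst (_≤ P) (𝔼-const t xs 0ℚ) (𝔼-mono 0≤t t≤1 xs λ A → 0≤𝟙 (covers? A))

      P≤1 : P ≤ 1ℚ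
      P≤1 = subst (P ≤_) (𝔼-const t xs 1ℚ) (𝔼-mono 0≤t t≤1 xs λ A → 𝟙≤1 (covers? A))

      union-bound : 1ℚ ≤ P + μ
      union-bound = subst₂ _≤_ (𝔼-const t xs 1ℚ)
        (trans (𝔼-+ t xs (𝟙 ∘ covers?) #uncovered) (cong (P +_) 𝔼#uncovered))
        (𝔼-mono 0≤t t≤1 xs pointwise)
        where
        pointwise : ∀ A → 1ℚ ≤ 𝟙 (covers? A) + #uncovered A
        pointwise A with covers? A
        ... | yes _    = x≤x+y 1ℚ (0≤#uncovered A)
        ... | no  ¬all = subst (1ℚ ≤_) (sym (ℚ.+-identityˡ _)) (¬covers⇒1≤ ¬all)

      -- On a cover the number N of uncovered elements is 0, so μ² times the indicator of covering
      -- is at most (N - μ)² pointwise. The cross term 2μN stands on the left, which leaves only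
      -- sums to take expectations of. The outcome is μ²P ≤ μD, from which one factor μ is cancelled
      -- when it is positive.
      chebyshev : ∀ {D} → 0ℚ ≤ D → (∀ y → y ∈ ys → ∑ ys (common y) ≤ D) → P * μ ≤ D
      chebyshev {D} 0≤D h with ℚ._≤?_ μ 0ℚ
      ... | yes μ≤0 = ℚ.≤-trans (*-monoˡ-≤ 0≤P μ≤0) (subst (_≤ D) (sym (ℚ.*-zeroʳ P)) 0≤D)
      ... | no  μ≰0 = *-cancelʳ-≤ (ℚ.≰⇒> μ≰0) (diff⇒≤ (subst (0ℚ ≤_)
          (solve 3 (λ P μ D → (μ :* μ :+ μ :* D :+ μ :* μ) :- (μ :* μ :* P :+ (μ :+ μ) :* μ) :=
            D :* μ :- P :* μ :* μ) refl P μ D)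
          (≤⇒diff (begin
            μ * μ * P + (μ + μ) * μ
              ≡⟨ cong₂ _+_ (𝔼-*ˡ t xs (μ * μ) _)
                (trans (𝔼-*ˡ t xs (μ + μ) _) (cong ((μ + μ) *_) 𝔼#uncovered)) ⟨
            𝔼 t xs (λ A → μ * μ * 𝟙 (covers? A)) + 𝔼 t xs (λ A → (μ + μ) * #uncovered A)
              ≡⟨ 𝔼-+ t xs _ _ ⟨
            𝔼 t xs (λ A → μ * μ * 𝟙 (covers? A) + (μ + μ) * #uncovered A)
              ≤⟨ 𝔼-mono 0≤t t≤1 xs pointwise ⟩
            𝔼 t xs (λ A → #uncovered A * #uncovered A + μ * μ)
              ≡⟨ trans (𝔼-+ t xs _ _) (cong (𝔼 t xs (λ A → #uncovered A * #uncovered A) +_)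
                (𝔼-const t xs (μ * μ))) ⟩
            𝔼 t xs (λ A → #uncovered A * #uncovered A) + μ * μ
              ≤⟨ ℚ.+-monoˡ-≤ (μ * μ) (second-moment≤ h) ⟩
            μ * μ + μ * D + μ * μ ∎))))
        where
        open ℚ.≤-Reasoning
        pointwise : ∀ A → μ * μ * 𝟙 (covers? A) + (μ + μ) * #uncovered A ≤
          #uncovered A * #uncovered A + μ * μ
        pointwise A with covers? A
        ... | yes all = ℚ.≤-reflexive (trans (cong (λ z → μ * μ * 1ℚ + (μ + μ) * z) (covers⇒0 all))
            (trans (solve 1 (λ μ → μ :* μ :* con 1ℚ :+ (μ :+ μ) :* con 0ℚ :=
              con 0ℚ :* con 0ℚ :+ μ :* μ) refl μ)
              (cong (λ z → z * z + μ * μ) (sym (covers⇒0 all)))))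
        ... | no _ = diff⇒≤ (subst (0ℚ ≤_)
            (solve 2 (λ μ N → (N :- μ) :* (N :- μ) :=
              N :* N :+ μ :* μ :- (μ :* μ :* con 0ℚ :+ (μ :+ μ) :* N)) refl μ (#uncovered A))
            (0≤² (#uncovered A - μ)))

      -- Double counting: the sum of `common y y′` over y′ counts pairs (x, y′) with x related to
      -- both, and choosing x first gives at most a choices of x and then b of y′.
      second-moment-bound : ∀ {a b} → (∀ {y} → y ∈ ys → degree y ℕ.≤ a) →
        (∀ {x} → x ∈ xs → count (R? x) ys ℕ.≤ b) → P * μ ≤ ι (a ℕ.* b)
      second-moment-bound {a} {b} deg codeg = chebyshev (0≤ι (a ℕ.* b)) λ y y∈ → begin
        ∑ ys (λ y′ → ∑ xs (λ x → c x y * c x y′))  ≡⟨ ∑-swap ys xs _ ⟩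
        ∑ xs (λ x → ∑ ys (λ y′ → c x y * c x y′))
          ≡⟨ ∑-cong xs (λ x → trans (∑-*ˡ ys (c x y) (c x)) (cong (c x y *_) (∑-𝟙 (R? x) ys))) ⟩
        ∑ xs (λ x → c x y * ι (count (R? x) ys))
          ≤⟨ ∑-mono xs (λ {x} x∈ → *-monoˡ-≤ (0≤𝟙 (R? x y)) (ι-mono (codeg x∈))) ⟩
        ∑ xs (λ x → c x y * ι b)
          ≡⟨ trans (∑-*ʳ xs (ι b) _) (cong (_* ι b) (∑-𝟙 (λ x → R? x y) xs)) ⟩
        ι (degree y) * ι b                         ≤⟨ *-monoʳ-≤ (0≤ι b) (ι-mono (deg y∈)) ⟩
        ι a * ι b                                  ≡⟨ ι-* a b ⟨
        ι (a ℕ.* b)                                ∎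
        where open ℚ.≤-Reasoning

    μ≤ : ∀ {d} → (∀ {y} → y ∈ ys → d ℕ.≤ degree y) → μ ≤ ι (length ys) * (1ℚ - t) ^ d
    μ≤ {d} h = subst (μ ≤_) (∑-const ys ((1ℚ - t) ^ d)) (∑-mono ys λ {y} y∈ →
      subst (_≤ (1ℚ - t) ^ d) (sym (e≡^ y)) (^-antimonoʳ-≤ 0≤1-t (1-x≤1 0≤t) (h y∈)))

    μ≥ : ∀ {d} → (∀ {y} → y ∈ ys → degree y ℕ.≤ d) → ι (length ys) * (1ℚ - t) ^ d ≤ μ
    μ≥ {d} h = subst (_≤ μ) (∑-const ys ((1ℚ - t) ^ d)) (∑-mono ys λ {y} y∈ →
      subst ((1ℚ - t) ^ d ≤_) (sym (e≡^ y)) (^-antimonoʳ-≤ 0≤1-t (1-x≤1 0≤t) (h y∈)))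

open RandomSubsets

-- Covers of a permutation as insertions of one letter.

module Insertions where
  open import Data.Fin.Base using (_<_; _≤_)

  private
    variable
      A B : Set
      n : ℕ

  lookup-injective : ∀ {xs : List A} → List.Unique xs → ∀ i j → List.lookup xs i ≡
    List.lookup xs j → i ≡ j
  lookup-injective (px ∷ u) zero    zero    e = refl
  lookup-injective (px ∷ u) zero    (suc j) e = ⊥-elim (ListAll.lookup px (∈.∈-lookup j) e)
  lookup-injective (px ∷ u) (suc i) zero    e = ⊥-elim (ListAll.lookup px (∈.∈-lookup i) (sym e))
  lookup-injective (px ∷ u) (suc i) (suc j) e = cong suc (lookup-injective u i j e)

  -- The partner of x may depend on the proof that x belongs to `xs`, as the position of an inserted
  -- letter does. Asking injectivity of the relation makes every such choice injective.
  length-≤ : ∀ {xs : List A} {ys : List B} (R : A → B → Set) → List.Unique xs →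
    (∀ {x} → x ∈ xs → ∃ λ y → y ∈ ys × R x y) →
    (∀ {x x′ y} → R x y → R x′ y → x ≡ x′) →
    length xs ℕ.≤ length ys
  length-≤ {xs = xs} {ys} R u total injective = Fin.injective⇒≤ {f = f} λ {i} {j} → f-injective i j
    where
    image : ∀ i → ∃ λ y → y ∈ ys × R (List.lookup xs i) y
    image i = total (∈.∈-lookup i)
    f : Fin (length xs) → Fin (length ys)
    f i = Any.index (proj₁ (proj₂ (image i)))
    f-injective : ∀ i j → f i ≡ f j → i ≡ j
    f-injective i j e = lookup-injective u i j (injective (proj₂ (proj₂ (image i)))
      (subst (R (List.lookup xs j)) (sym same) (proj₂ (proj₂ (image j)))))
      where
      same : proj₁ (image i) ≡ proj₁ (image j)
      same = trans (Any.lookup-index (proj₁ (proj₂ (image i))))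
        (trans (cong (List.lookup ys) e) (sym (Any.lookup-index (proj₁ (proj₂ (image j))))))

  length-allFin : ∀ n → length (allFin n) ≡ n
  length-allFin n = List.length-tabulate _

  length-cartesianProduct : ∀ (xs : List A) (ys : List B) →
    length (cartesianProduct xs ys) ≡ length xs ℕ.* length ys
  length-cartesianProduct []       ys = refl
  length-cartesianProduct (x ∷ xs) ys = trans (List.length-++ (List.map (x ,_) ys))
    (cong₂ ℕ._+_ (List.length-map (x ,_) ys) (length-cartesianProduct xs ys))

  words-unique : ∀ m k → List.Unique (words m k)
  words-unique m zero    = ListAll.[] ∷ []
  words-unique m (suc k) = ListUnique.cartesianProductWith⁺ _∷_ Vec.∷-injective
    (ListUnique.allFin⁺ m) (words-unique m k)

  S-unique : ∀ n → List.Unique (S n)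
  S-unique n = ListUnique.filter⁺ unique? (words-unique n n)

  ∈S⁺ : {π : Word n n} → Unique π → π ∈ S n
  ∈S⁺ {π = π} u = ∈.∈-filter⁺ unique? (∈-words π) u

  ∈S⁻ : {π : Word n n} → π ∈ S n → Unique π
  ∈S⁻ {n} π∈ = proj₂ (∈.∈-filter⁻ unique? {xs = words n n} π∈)

  -- Different pairs (i, v) can give the same word: inserting x directly before a letter x of `π`,
  -- or x + 1 directly after it, makes no difference.
  insert : Fin (suc n) → Fin (suc n) → Word n n → Word (suc n) (suc n)
  insert i v π = insertAt (map (punchIn v) π) i v

  lookup-insert : ∀ (i v : Fin (suc n)) π → lookup (insert i v π) i ≡ v
  lookup-insert i v π = Vec.insertAt-lookup (map (punchIn v) π) i v

  lookup-insert-punchIn : ∀ (i v : Fin (suc n)) π j → lookup (insert i v π) (punchIn i j) ≡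
    punchIn v (lookup π j)
  lookup-insert-punchIn i v π j = trans (Vec.insertAt-punchIn (map (punchIn v) π) i v j)
    (Vec.lookup-map j (punchIn v) π)

  map-injective : {f : A → B} → (∀ {x y} → f x ≡ f y → x ≡ y) →
    ∀ {n} {xs ys : Vec A n} → map f xs ≡ map f ys → xs ≡ ys
  map-injective inj {xs = []}     {[]}     e = refl
  map-injective inj {xs = x ∷ xs} {y ∷ ys} e =
    cong₂ _∷_ (inj (Vec.∷-injectiveˡ e)) (map-injective inj (Vec.∷-injectiveʳ e))

  insert-injective : ∀ {i v : Fin (suc n)} {π π′} → insert i v π ≡ insert i v π′ → π ≡ π′
  insert-injective {i = i} {v} {π} {π′} e = map-injective (Fin.punchIn-injective v _ _)
    (trans (sym (Vec.removeAt-insertAt (map (punchIn v) π) i v))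
      (trans (cong (λ w → removeAt w i) e) (Vec.removeAt-insertAt (map (punchIn v) π′) i v)))

  All-insertAt : ∀ {P : A → Set} {xs : Vec A n} i {v} → All P xs → P v → All P (insertAt xs i v)
  All-insertAt zero    ps       pv = pv ∷ ps
  All-insertAt (suc i) (p ∷ ps) pv = p ∷ All-insertAt i ps pv

  Unique-insertAt : ∀ {xs : Vec A n} i {v} → Unique xs → All (v ≢_) xs → Unique (insertAt xs i v)
  Unique-insertAt zero    u        v∉       = v∉ ∷ u
  Unique-insertAt (suc i) (px ∷ u) (v≢ ∷ v∉) = All-insertAt i px (v≢ ∘ sym) ∷ Unique-insertAt i u v∉

  Unique-insert : ∀ i v {π : Word n n} → Unique π → Unique (insert i v π)
  Unique-insert i v {π} u = Unique-insertAt i (Unique.map⁺ (Fin.punchIn-injective v _ _) u)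
    (All.map⁺ (All.universal (λ x → Fin.punchInᵢ≢i v x ∘ sym) π))

  All-removeAt : ∀ {P : A → Set} {xs : Vec A (suc n)} i → All P xs →
    All P (removeAt xs i) × P (lookup xs i)
  All-removeAt zero    (p ∷ ps)         = ps , p
  All-removeAt (suc i) (p ∷ ps@(_ ∷ _)) = let qs , q = All-removeAt i ps in p ∷ qs , q

  Unique-removeAt : ∀ {xs : Vec A (suc n)} i → Unique xs →
    Unique (removeAt xs i) × All (lookup xs i ≢_) (removeAt xs i)
  Unique-removeAt zero    (px ∷ u)         = u , px
  Unique-removeAt (suc i) (px ∷ u@(_ ∷ _)) =
    let u′ , ≢′ = Unique-removeAt i u
        qs , q  = All-removeAt i px
    in qs ∷ u′ , q ∘ sym ∷ ≢′

  Unique-map⁻ : ∀ {f : A → B} {xs : Vec A n} → Unique (map f xs) → Unique xs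
  Unique-map⁻ {xs = []}     []       = []
  Unique-map⁻ {f = f} {xs = x ∷ xs} (px ∷ u) =
    All.map (λ ne → ne ∘ cong f) (All.map⁻ px) ∷ Unique-map⁻ u

  punchOut-all : ∀ {m} {v : Fin (suc m)} {w : Word (suc m) n} → All (v ≢_) w → ∃ λ (π : Word m n) →
    map (punchIn v) π ≡ w
  punchOut-all []        = [] , refl
  punchOut-all (v≢ ∷ v∉) =
    let π , e = punchOut-all v∉
    in punchOut v≢ ∷ π , cong₂ _∷_ (Fin.punchIn-punchOut v≢) e

  uninsert : ∀ {ρ : Word (suc n) (suc n)} i → Unique ρ →
    ∃ λ π → Unique π × map (punchIn (lookup ρ i)) π ≡ removeAt ρ i × ρ ≡ insert i (lookup ρ i) π
  uninsert {ρ = ρ} i u =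
    let u′ , v∉ = Unique-removeAt i u
        π , e   = punchOut-all v∉
    in π , Unique-map⁻ (subst Unique (sym e) u′) , e
     , trans (sym (Vec.insertAt-removeAt ρ i)) (cong (λ w → insertAt w i (lookup ρ i)) (sym e))

  ⊆-insertAt : ∀ (xs : Vec A n) i v → toList xs ⊆ toList (insertAt xs i v)
  ⊆-insertAt xs       zero    v = v ∷ʳ ⊆-refl
  ⊆-insertAt (x ∷ xs) (suc i) v = refl ∷ ⊆-insertAt xs i v

  punchIn-mono-< : ∀ (v : Fin (suc n)) {x y} → x < y → punchIn v x < punchIn v y
  punchIn-mono-< v {x} {y} x<y = ℕ.≰⇒> (ℕ.<⇒≱ x<y ∘ Fin.punchIn-cancel-≤ v y x)

  punchIn-cancel-< : ∀ (v : Fin (suc n)) {x y} → punchIn v x < punchIn v y → x < y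
  punchIn-cancel-< v {x} {y} h = ℕ.≰⇒> (ℕ.<⇒≱ h ∘ Fin.punchIn-mono-≤ v y x)

  punchIn-≅ : ∀ (v : Fin (suc n)) {k} (π : Word n k) → map (punchIn v) π ≅ π
  punchIn-≅ v π i j rewrite Vec.lookup-map i (punchIn v) π | Vec.lookup-map j (punchIn v) π =
    mk⇔ (punchIn-cancel-< v) (punchIn-mono-< v)

  insert-covers : ∀ i v (π : Word n n) → insert i v π Covers π
  insert-covers i v π = map (punchIn v) π , ⊆-insertAt _ i v , punchIn-≅ v π

  ⊆⇒removeAt : ∀ (w : Vec A n) (ρ : Vec A (suc n)) → toList w ⊆ toList ρ → ∃ λ i → w ≡ removeAt ρ i
  ⊆⇒removeAt []      (x ∷ []) τ = zero , refl
  ⊆⇒removeAt (y ∷ w) (x ∷ ρ)  (_ ∷ʳ τ) = zero ,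
    trans (sym (Vec.cast-is-id refl (y ∷ w)))
      (Vec.toList-injective refl (y ∷ w) ρ (Pointwise.Pointwise-≡⇒≡
      (Sublist.toPointwise (trans (Vec.length-toList (y ∷ w)) (sym (Vec.length-toList ρ))) τ)))
  ⊆⇒removeAt (y ∷ w) (x ∷ ρ@(_ ∷ _)) (refl ∷ τ) =
    let i , e = ⊆⇒removeAt w ρ τ
    in suc i , cong (y ∷_) e

  ≅-sym : ∀ {a b k} {u : Word a k} {v : Word b k} → u ≅ v → v ≅ u
  ≅-sym h i j = mk⇔ (Equivalence.from (h i j)) (Equivalence.to (h i j))

  ≅-trans : ∀ {a b c k} {u : Word a k} {v : Word b k} {w : Word c k} → u ≅ v → v ≅ w → u ≅ w
  ≅-trans g h i j = mk⇔ (Equivalence.to (h i j) ∘ Equivalence.to (g i j))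
    (Equivalence.from (g i j) ∘ Equivalence.from (h i j))

  Unique⇒surjective : ∀ {π : Word n n} → Unique π → ∀ v → ∃ λ j → lookup π j ≡ v
  Unique⇒surjective {suc n} {π = π} u v with uninsert zero u
  ... | π′ , u′ , _ , e with lookup π zero Fin.≟ v
  ... | yes a≡v = zero , a≡v
  ... | no  a≢v with Unique⇒surjective u′ (punchOut a≢v)
  ... | j , e′ = suc j , trans (cong (λ w → lookup w (suc j)) e)
    (trans (lookup-insert-punchIn zero (lookup π zero) π′ j)
      (trans (cong (punchIn (lookup π zero)) e′) (Fin.punchIn-punchOut a≢v)))

  -- By induction on the letter π j: the position holding the preceding letter
  -- must also hold a smaller letter in u.
  ≅⇒≤ : ∀ {u π : Word n n} → Unique π → u ≅ π → ∀ j → lookup π j ≤ lookup u j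
  ≅⇒≤ {n} {u} {π} uniq h j = go (toℕ (lookup π j)) j refl
    where
    go : ∀ m j → toℕ (lookup π j) ≡ m → m ℕ.≤ toℕ (lookup u j)
    go zero    j e = z≤n
    go (suc m) j e = ℕ.≤-<-trans (go m j′ π[j′]≡m)
      (Equivalence.from (h j′ j) (ℕ.≤-reflexive (trans (cong suc π[j′]≡m) (sym e))))
      where
      m<n : m ℕ.< n
      m<n = ℕ.<-trans (ℕ.≤-reflexive (sym e)) (Fin.toℕ<n (lookup π j))
      j′ = proj₁ (Unique⇒surjective uniq (fromℕ< m<n))
      π[j′]≡m : toℕ (lookup π j′) ≡ m
      π[j′]≡m = trans (cong toℕ (proj₂ (Unique⇒surjective uniq (fromℕ< m<n)))) (Fin.toℕ-fromℕ< m<n)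

  ≅⇒≡ : ∀ {u π : Word n n} → Unique u → Unique π → u ≅ π → u ≡ π
  ≅⇒≡ {u = u} {π} uu uπ h = trans (sym (Vec.tabulate∘lookup u)) (trans
    (Vec.tabulate-cong λ j → Fin.toℕ-injective
      (ℕ.≤-antisym (≅⇒≤ {u = π} uu (≅-sym {u = u} {π} h) j) (≅⇒≤ {u = u} uπ h j)))
    (Vec.tabulate∘lookup π))

  -- Deleting position i from `ρ` and closing the gap in the letters leaves a permutation
  -- order-isomorphic to `π`, hence `π` itself. The inserted letter is read off `ρ`, so for fixed
  -- `ρ` the position alone determines `π`; this is what `codegree≤` counts.
  covers⇒insert : ∀ {ρ : Word (suc n) (suc n)} {π} → Unique ρ → Unique π → ρ Covers π →
    ∃ λ i → ρ ≡ insert i (lookup ρ i) π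
  covers⇒insert {ρ = ρ} {π} uρ uπ (w , w⊆ρ , w≅π) =
    let i , w≡         = ⊆⇒removeAt w ρ w⊆ρ
        π′ , uπ′ , e , ρ≡ = uninsert i uρ
        π′≅π           = ≅-trans {u = π′} {w} {π} (≅-sym {u = w} {π′}
                           (subst (_≅ π′) (trans e (sym w≡)) (punchIn-≅ (lookup ρ i) π′))) w≅π
    in i , trans ρ≡ (cong (insert i (lookup ρ i)) (≅⇒≡ uπ′ uπ π′≅π))

  length-S : ∀ n → length (S n) ≡ n !
  length-S zero    = refl
  length-S (suc n) = trans (ℕ.≤-antisym upper lower)
    (trans (length-cartesianProduct (allFin (suc n)) (S n))
    (cong₂ ℕ._*_ (length-allFin (suc n)) (length-S n)))
    where
    pairs = cartesianProduct (allFin (suc n)) (S n)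
    upper : length (S (suc n)) ℕ.≤ length pairs
    upper = length-≤ (λ ρ (v , π) → ρ ≡ insert zero v π) (S-unique (suc n))
      (λ {ρ} ρ∈ → let π , u , _ , e = uninsert zero (∈S⁻ ρ∈) in
        (lookup ρ zero , π) , ∈.∈-cartesianProduct⁺ (∈.∈-allFin _) (∈S⁺ u) , e)
      (λ e e′ → trans e (sym e′))
    lower : length pairs ℕ.≤ length (S (suc n))
    lower = length-≤ (λ (v , π) ρ → ρ ≡ insert zero v π)
      (ListUnique.cartesianProduct⁺ (ListUnique.allFin⁺ (suc n)) (S-unique n))
      (λ {(v , π)} m → let _ , π∈ = ∈.∈-cartesianProduct⁻ (allFin (suc n)) (S n) m in
        insert zero v π , ∈S⁺ (Unique-insert zero v (∈S⁻ π∈)) , refl)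
      (λ {(v , π)} {(v′ , π′)} e e′ → inj (trans (sym e) e′))
      where
      inj : ∀ {v v′ : Fin (suc n)} {π π′} → insert zero v π ≡ insert zero v′ π′ → (v , π) ≡
        (v′ , π′)
      inj e with refl ← Vec.∷-injectiveˡ e = cong (_ ,_) (insert-injective {i = zero} e)

  degree≤ : ∀ {π : Word n n} → π ∈ S n → count (λ ρ → covers? ρ π) (S (suc n)) ℕ.≤ suc n ℕ.* suc n
  degree≤ {n} {π} π∈ = ℕ.≤-trans
    (length-≤ {ys = cartesianProduct (allFin (suc n)) (allFin (suc n))}
      (λ ρ (i , v) → ρ ≡ insert i v π)
      (ListUnique.filter⁺ (λ ρ → covers? ρ π) (S-unique (suc n)))
      (λ {ρ} m → let ρ∈ , c = ∈.∈-filter⁻ (λ ρ → covers? ρ π) {xs = S (suc n)} m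
                     i , e  = covers⇒insert (∈S⁻ ρ∈) (∈S⁻ π∈) c
                 in (i , lookup ρ i) , ∈.∈-cartesianProduct⁺ (∈.∈-allFin i) (∈.∈-allFin _) , e)
      (λ e e′ → trans e (sym e′)))
    (ℕ.≤-reflexive (trans (length-cartesianProduct (allFin (suc n)) (allFin (suc n)))
      (cong₂ ℕ._*_ (length-allFin (suc n)) (length-allFin (suc n)))))

  codegree≤ : ∀ {ρ : Word (suc n) (suc n)} → ρ ∈ S (suc n) → count (covers? ρ) (S n) ℕ.≤ suc n
  codegree≤ {n} {ρ} ρ∈ = ℕ.≤-trans
    (length-≤ {ys = allFin (suc n)} (λ π i → ρ ≡ insert i (lookup ρ i) π)
      (ListUnique.filter⁺ (covers? ρ) (S-unique n))
      (λ m → let π∈ , c = ∈.∈-filter⁻ (covers? ρ) {xs = S n} m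
                 i , e  = covers⇒insert (∈S⁻ ρ∈) (∈S⁻ π∈) c
             in i , ∈.∈-allFin i , e)
      (λ {_} {_} {i} e e′ → insert-injective {i = i} (trans (sym e) e′)))
    (ℕ.≤-reflexive (length-allFin (suc n)))

  -- Distinct insertions, for the lower bound on the number of covers.

  punchIn-≥ : ∀ {i : Fin (suc n)} {j : Fin n} → i ≤ inject₁ j → punchIn i j ≡ suc j
  punchIn-≥ {i = zero}              _       = refl
  punchIn-≥ {i = suc i} {j = suc j} (s≤s h) = cong suc (punchIn-≥ h)

  punchIn-image : ∀ (v : Fin (suc n)) x → punchIn v x ≡ inject₁ x ⊎ punchIn v x ≡ suc x
  punchIn-image zero    x       = inj₂ refl
  punchIn-image (suc v) zero    = inj₁ refl
  punchIn-image (suc v) (suc x) with punchIn-image v x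
  ... | inj₁ e = inj₁ (cong suc e)
  ... | inj₂ e = inj₂ (cong suc e)

  -- Enumerates the letters other than x and x + 1.
  skip : ∀ {k} → Fin (suc k) → Fin k → Fin (suc (suc k))
  skip x m = punchIn (inject₁ x) (punchIn x m)

  -- Making room for `v` leaves the letter x in place or raises it to x + 1, and these are the two
  -- values that `skip x` omits.
  punchIn≢skip : ∀ {k} v (x : Fin (suc k)) m → punchIn v x ≢ skip x m
  punchIn≢skip v x m e with punchIn-image v x
  ... | inj₁ e′ = Fin.punchInᵢ≢i (inject₁ x) (punchIn x m) (trans (sym e) e′)
  ... | inj₂ e′ = Fin.punchInᵢ≢i x m (Fin.punchIn-injective (inject₁ x) _ _
    (trans (sym e) (trans e′ (sym (punchIn-≥ {i = inject₁ x} ℕ.≤-refl)))))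

  -- A word arising from two insertions forces the later of the two inserted letters
  -- to be adjacent in value to the letter directly before it.
  insert-skip-≢ : ∀ {k} (π : Word (suc k) (suc k)) {j j′ m m′} → j < j′ →
    insert (suc j) (skip (lookup π j) m) π ≢ insert (suc j′) (skip (lookup π j′) m′) π
  insert-skip-≢ π {j} {j′} {m} {m′} j<j′ e = punchIn≢skip v (lookup π j′) m′ (begin
    punchIn v (lookup π j′)
      ≡⟨ lookup-insert-punchIn (suc j) v π j′ ⟨
    lookup (insert (suc j) v π) (punchIn (suc j) j′)
      ≡⟨ cong (lookup (insert (suc j) v π)) (punchIn-≥ j<′) ⟩
    lookup (insert (suc j) v π) (suc j′)                     ≡⟨ cong (λ w → lookup w (suc j′)) e ⟩
    lookup (insert (suc j′) (skip (lookup π j′) m′) π) (suc j′) ≡⟨ lookup-insert (suc j′) _ π ⟩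
    skip (lookup π j′) m′                                    ∎)
    where
    open ≡-Reasoning
    v = skip (lookup π j) m
    j<′ : suc j ≤ inject₁ j′
    j<′ = subst (suc (toℕ j) ℕ.≤_) (sym (Fin.toℕ-inject₁ j′)) j<j′

  insert-skip-injective : ∀ {k} (π : Word (suc k) (suc k)) {j j′ m m′} →
    insert (suc j) (skip (lookup π j) m) π ≡ insert (suc j′) (skip (lookup π j′) m′) π → (j , m) ≡
      (j′ , m′)
  insert-skip-injective π {j} {j′} {m} {m′} e with Fin.<-cmp j j′
  ... | tri< j<j′ _ _ = ⊥-elim (insert-skip-≢ π {m = m} {m′} j<j′ e)
  ... | tri> _ _ j′<j = ⊥-elim (insert-skip-≢ π {m = m′} {m} j′<j (sym e))
  ... | tri≈ _ refl _ = cong (j ,_) (Fin.punchIn-injective (lookup π j) _ _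
    (Fin.punchIn-injective (inject₁ (lookup π j)) _ _
    (trans (sym (lookup-insert (suc j) _ π)) (trans (cong (λ w → lookup w (suc j)) e)
      (lookup-insert (suc j) _ π)))))

  -- Insert directly after one of the n letters of `π`, with any of the n - 1 values that `skip`
  -- allows next to it. Excluding the two neighbouring values removes the coincidences between
  -- insertions.
  degree≥ : {π : Word n n} → π ∈ S n → n ℕ.* pred n ℕ.≤ count (λ ρ → covers? ρ π) (S (suc n))
  degree≥ {zero}      π∈ = z≤n
  degree≥ {suc k} {π} π∈ = ℕ.≤-trans
    (ℕ.≤-reflexive (sym (trans (length-cartesianProduct (allFin (suc k)) (allFin k))
      (cong₂ ℕ._*_ (length-allFin (suc k)) (length-allFin k)))))
    (length-≤ (λ (j , m) ρ → ρ ≡ insert (suc j) (skip (lookup π j) m) π)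
      (ListUnique.cartesianProduct⁺ (ListUnique.allFin⁺ (suc k)) (ListUnique.allFin⁺ k))
      (λ {(j , m)} _ → let v = skip (lookup π j) m in
        insert (suc j) v π
        , ∈.∈-filter⁺ (λ ρ → covers? ρ π) (∈S⁺ (Unique-insert (suc j) v (∈S⁻ π∈)))
          (insert-covers (suc j) v π)
        , refl)
      (λ e e′ → insert-skip-injective π (trans (sym e) e′)))

open Insertions

-- From rational estimates to limits of real probabilities.

module Convergence where
  open import Data.Rational.Base using (_≤_; _<_; _+_; _*_; _-_; -_; ∣_∣)
  open +-*-Solver using (solve; _:+_; _:*_; _:-_; :-_; _:=_; con)

  Close : (x y : ℕ → ℚ) → Set
  Close x y = ∀ ε → 0ℚ < ε → ∃ λ N → ∀ m → N ℕ.≤ m → ∣ x m - y m ∣ ≤ ε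

  interleave : (x y : ℕ → ℚ) → ℕ → ℚ
  interleave x y zero          = x 0
  interleave x y (suc zero)    = y 0
  interleave x y (suc (suc k)) = interleave (x ∘ suc) (y ∘ suc) k

  twice : ℕ → ℕ
  twice zero    = zero
  twice (suc m) = suc (suc (twice m))

  n≤twice : ∀ n → n ℕ.≤ twice n
  n≤twice zero    = ℕ.z≤n
  n≤twice (suc n) = ℕ.s≤s (ℕ.m≤n⇒m≤1+n (n≤twice n))

  interleave-even : ∀ x y m → interleave x y (twice m) ≡ x m
  interleave-even x y zero    = refl
  interleave-even x y (suc m) = interleave-even (x ∘ suc) (y ∘ suc) m

  interleave-odd : ∀ x y m → interleave x y (suc (twice m)) ≡ y m
  interleave-odd x y zero    = refl
  interleave-odd x y (suc m) = interleave-odd (x ∘ suc) (y ∘ suc) m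

  interleave-from : ∀ {x y N k} → twice N ℕ.≤ k →
    ∃ λ m → N ℕ.≤ m × (interleave x y k ≡ x m ⊎ interleave x y k ≡ y m)
  interleave-from {N = zero} {zero}        _ = 0 , ℕ.z≤n , inj₁ refl
  interleave-from {N = zero} {suc zero}    _ = 0 , ℕ.z≤n , inj₂ refl
  interleave-from {N = zero} {suc (suc k)} _ =
    let m , _ , e = interleave-from {N = zero} {k} ℕ.z≤n in suc m , ℕ.z≤n , e
  interleave-from {N = suc N} (ℕ.s≤s (ℕ.s≤s h)) =
    let m , N≤m , e = interleave-from {N = N} h in suc m , ℕ.s≤s N≤m , e

  ∣∣-triangle : ∀ a b c → ∣ a - c ∣ ≤ ∣ a - b ∣ + ∣ b - c ∣
  ∣∣-triangle a b c = subst (λ z → ∣ z ∣ ≤ ∣ a - b ∣ + ∣ b - c ∣)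
    (solve 3 (λ a b c → a :- b :+ (b :- c) := a :- c) refl a b c) (ℚ.∣p+q∣≤∣p∣+∣q∣ (a - b) (b - c))

  interleave-cauchy : ∀ {x y} → Cauchy x → Close x y → Cauchy (interleave x y)
  interleave-cauchy {x} {y} cx close ε 0<ε =
    let N₁ , h₁ = cx δ 0<δ
        N₂ , h₂ = close δ 0<δ
        N = N₁ ℕ.⊔ N₂
        near : ∀ k → twice N ℕ.≤ k → ∣ interleave x y k - x N ∣ ≤ ½ * ε
        near k h = let m , N≤m , e = interleave-from {x} {y} {N} h in
          subst (∣ interleave x y k - x N ∣ ≤_) (halves (½ * ε))
            (ℚ.≤-trans (∣∣-triangle (interleave x y k) (x m) (x N)) (ℚ.+-mono-≤
              (off e (subst (_≤ δ) (∣-∣-swap (x m) (y m)) (h₂ m (ℕ.m⊔n≤o⇒n≤o N₁ N₂ N≤m))))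
              (h₁ m N (ℕ.m⊔n≤o⇒m≤o N₁ N₂ N≤m) (ℕ.m≤m⊔n N₁ N₂))))
    in twice N , λ j k hj hk → subst (∣ interleave x y j - interleave x y k ∣ ≤_) (halves ε)
         (ℚ.≤-trans (∣∣-triangle (interleave x y j) (x N) (interleave x y k))
           (ℚ.+-mono-≤ (near j hj)
           (subst (_≤ ½ * ε) (∣-∣-swap (interleave x y k) (x N)) (near k hk))))
    where
    δ = ½ * (½ * ε)
    0<δ : 0ℚ < δ
    0<δ = ½-pos (½-pos 0<ε)
    off : ∀ {z a b} → z ≡ a ⊎ z ≡ b → ∣ b - a ∣ ≤ δ → ∣ z - a ∣ ≤ δ
    off {a = a} (inj₁ refl) h = subst (λ z → ∣ z ∣ ≤ δ) (sym (ℚ.+-inverseʳ a)) (ℚ.<⇒≤ 0<δ)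
    off         (inj₂ refl) h = h

  -- A function of reals that acts termwise on representatives is continuous:
  -- apply it to the interleaving of two close representatives.
  termwise-continuous : ∀ (f : ℝ → ℝ) F → (∀ x m → seq (f x) m ≡ F (seq x m)) →
    ∀ x {y} → Close (seq x) y → Close (F ∘ seq x) (F ∘ y)
  termwise-continuous f F e x {y} close ε 0<ε =
    let z = mkℝ (interleave (seq x) y) (interleave-cauchy (cauchy x) close)
        N , h = cauchy (f z) ε 0<ε
    in N , λ m N≤m → let N≤2m = ℕ.≤-trans N≤m (n≤twice m) in
      subst₂ (λ a b → ∣ a - b ∣ ≤ ε)
        (trans (e z (twice m)) (cong F (interleave-even (seq x) y m)))
        (trans (e z (suc (twice m))) (cong F (interleave-odd (seq x) y m)))
        (h (twice m) (suc (twice m)) N≤2m (ℕ.m≤n⇒m≤1+n N≤2m))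

  -- Real inequalities lo ≤ p ≤ hi let a rational term of p miss the interval by a small error;
  -- moving it to the nearest point of the interval costs at most that error.
  clamp : ∀ {lo hi} → lo ≤ hi → ∀ q → ∃ λ c → lo ≤ c × c ≤ hi ×
    (∀ {ε} → 0ℚ ≤ ε → lo ≤ q + ε → q ≤ hi + ε → ∣ q - c ∣ ≤ ε)
  clamp {lo} {hi} lo≤hi q with ℚ._≤?_ q lo | ℚ._≤?_ q hi
  ... | yes q≤lo | _ = lo , ℚ.≤-refl , lo≤hi , λ {ε} 0≤ε h _ →
    ∣∣≤ (≤-from-shift (ℚ.≤-trans q≤lo (x≤x+y lo 0≤ε)))
        (subst (_≤ ε) (solve 2 (λ a b → a :- b := :- (b :- a)) refl lo q) (≤-from-shift h))
  ... | no q≰lo | yes q≤hi = q , ℚ.<⇒≤ (ℚ.≰⇒> q≰lo) , q≤hi , λ {ε} 0≤ε _ _ →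
    subst (λ z → ∣ z ∣ ≤ ε) (sym (ℚ.+-inverseʳ q)) 0≤ε
  ... | no _ | no q≰hi = hi , lo≤hi , ℚ.≤-refl , λ {ε} 0≤ε _ h →
    ∣∣≤ (≤-from-shift h) (subst (_≤ ε) (solve 2 (λ a b → a :- b := :- (b :- a)) refl hi q)
      (≤-from-shift (ℚ.≤-trans (ℚ.<⇒≤ (ℚ.≰⇒> q≰hi)) (x≤x+y q 0≤ε))))

  coverProbability : ℕ → ℚ → ℚ
  coverProbability n t = 𝔼 t (S (suc n)) (𝟙 ∘ isCover? n)

  -- The clamped terms `c m` form a sequence close to that of p, so by continuity the probabilities
  -- at both are close, and the rational bound applies at each `c m`.
  ∣ℙ-cover-l∣≤ε : ∀ n p {lo hi l ε} → lo ≤ hi → fromℚ lo Defs.≤ p → p Defs.≤ fromℚ hi →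
    (∀ t → lo ≤ t → t ≤ hi → ∣ coverProbability n t - l ∣ ≤ ε) →
    Defs.∣ ℙ-cover n p Defs.- fromℚ l ∣ Defs.≤ fromℚ ε
  ∣ℙ-cover-l∣≤ε n p {lo} {hi} {l} {ε} lo≤hi lo≤p p≤hi bound ε′ 0<ε′ =
    let N , h = termwise-continuous (ℙ-cover n) (coverProbability n)
                  (λ x → seq-ℙ x (S (suc n)) (isCover? n)) p close ε′ 0<ε′
    in N , λ m N≤m → begin
      ∣ seq (ℙ-cover n p) m - l ∣
        ≡⟨ cong (λ z → ∣ z - l ∣) (seq-ℙ p (S (suc n)) (isCover? n) m) ⟩
      ∣ coverProbability n (seq p m) - l ∣
        ≤⟨ ∣∣-triangle (coverProbability n (seq p m)) (coverProbability n (c m)) l ⟩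
      ∣ coverProbability n (seq p m) - coverProbability n (c m) ∣ + ∣ coverProbability n (c m) - l ∣
        ≤⟨ ℚ.+-mono-≤ (h m N≤m) (bound (c m) (proj₁ (proj₂ (clamped m)))
          (proj₁ (proj₂ (proj₂ (clamped m))))) ⟩
      ε′ + ε  ≡⟨ ℚ.+-comm ε′ ε ⟩
      ε + ε′  ∎
    where
    open ℚ.≤-Reasoning
    clamped : ∀ m → _
    clamped m = clamp lo≤hi (seq p m)
    c : ℕ → ℚ
    c m = proj₁ (clamped m)
    close : Close (seq p) c
    close δ 0<δ =
      let N₁ , h₁ = lo≤p δ 0<δ
          N₂ , h₂ = p≤hi δ 0<δ
      in N₁ ℕ.⊔ N₂ , λ m N≤m → proj₂ (proj₂ (proj₂ (clamped m))) (ℚ.<⇒≤ 0<δ)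
           (h₁ m (ℕ.m⊔n≤o⇒m≤o N₁ N₂ N≤m)) (h₂ m (ℕ.m⊔n≤o⇒n≤o N₁ N₂ N≤m))

  module _ (n : ℕ) {t : ℚ} (0≤t : 0ℚ ≤ t) (t≤1 : t ≤ 1ℚ) where
    private
      module Cov = Covering {R = Defs._Covers_} covers? (S (suc n)) (S n) 0≤t t≤1
    open ℚ.≤-Reasoning

    expectedUncovered : ℚ
    expectedUncovered = Cov.μ

    0≤coverProbability : 0ℚ ≤ coverProbability n t
    0≤coverProbability = Cov.0≤P (isCover? n)

    coverProbability≤1 : coverProbability n t ≤ 1ℚ
    coverProbability≤1 = Cov.P≤1 (isCover? n)

    coverProbability-second-moment : coverProbability n t * expectedUncovered ≤ ι (suc n) ^ 3
    coverProbability-second-moment = begin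
      coverProbability n t * Cov.μ         ≤⟨ Cov.second-moment-bound
        (isCover? n) degree≤ codegree≤ ⟩
      ι (suc n ℕ.* suc n ℕ.* suc n)        ≡⟨ trans (ι-* (suc n ℕ.* suc n) (suc n))
        (cong (_* ι (suc n)) (ι-* (suc n) (suc n))) ⟩
      ι (suc n) * ι (suc n) * ι (suc n)    ≡⟨ solve 1
        (λ x → x :* x :* x := x :* (x :* (x :* con 1ℚ))) refl (ι (suc n)) ⟩
      ι (suc n) ^ 3                        ∎

    coverProbability-union-bound : 1ℚ - coverProbability n t ≤ expectedUncovered
    coverProbability-union-bound =
      ≤-from-shift {1ℚ} {coverProbability n t} {Cov.μ} (Cov.union-bound (isCover? n))

    expectedUncovered≥ : ι (n !) * (1ℚ - t) ^ (suc n ℕ.* suc n) ≤ expectedUncovered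
    expectedUncovered≥ = subst (λ z → ι z * (1ℚ - t) ^ (suc n ℕ.* suc n) ≤ Cov.μ) (length-S n)
      (Cov.μ≥ degree≤)

    expectedUncovered≤ : expectedUncovered ≤ ι (n !) * (1ℚ - t) ^ (n ℕ.* pred n)
    expectedUncovered≤ = subst (λ z → Cov.μ ≤ ι z * (1ℚ - t) ^ (n ℕ.* pred n)) (length-S n)
      (Cov.μ≤ degree≥)

  coverProbability-upper : ∀ k {t} → 0ℚ ≤ t → t ≤ 1ℚ → let n = suc k in
    ι n * t ≤ H k + 1ℚ - C → coverProbability n t ≤ recip n
  coverProbability-upper k {t} 0≤t t≤1 h = *-cancelʳ-≤ (0<ι n) (begin
    coverProbability n t * ι (suc n)
      ≤⟨ lower-regime k (≤⇒diff t≤1) (1-x≤1 0≤t) h′ (0≤coverProbability n 0≤t t≤1)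
           (coverProbability-second-moment n 0≤t t≤1) (expectedUncovered≥ n 0≤t t≤1) ⟩
    1ℚ                  ≡⟨ ι-recip n ⟨
    recip n * ι (suc n) ∎)
    where
    open ℚ.≤-Reasoning
    n = suc k
    h′ : C + ι k - H k ≤ ι n * (1ℚ - t)
    h′ = diff⇒≤ (subst (0ℚ ≤_)
      (solve 4 (λ C i H t → H :+ con 1ℚ :- C :- (con 1ℚ :+ i) :* t :=
        (con 1ℚ :+ i) :* (con 1ℚ :- t) :- (C :+ i :- H)) refl C (ι k) (H k) t)
      (≤⇒diff h))

  coverProbability-lower : ∀ l {t} → 0ℚ ≤ t → t ≤ 1ℚ → let k = suc l; n = suc k in
    H k + 1ℚ ≤ ι n * t → 1ℚ - coverProbability n t ≤ 2ℚ * recip k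
  coverProbability-lower l {t} 0≤t t≤1 h = *-cancelʳ-≤ (0<ι k) (begin
    (1ℚ - coverProbability n t) * ι n
      ≤⟨ upper-regime l 0≤t t≤1 h (ℚ.≤-trans (coverProbability-union-bound n 0≤t t≤1)
        (expectedUncovered≤ n 0≤t t≤1)) ⟩
    2ℚ                    ≡⟨ ℚ.*-identityʳ 2ℚ ⟨
    2ℚ * 1ℚ               ≡⟨ cong (2ℚ *_) (ι-recip k) ⟨
    2ℚ * (recip k * ι n)  ≡⟨ ℚ.*-assoc 2ℚ (recip k) (ι n) ⟨
    2ℚ * recip k * ι n    ∎)
    where
    open ℚ.≤-Reasoning
    k = suc l
    n = suc k

  -- Comparison of log n with the harmonic sum, and the error functions.

  riemannSum-1 : ∀ k → riemannSum (suc k) 1 ≡ H k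
  riemannSum-1 k = cong (λ z → Σ< z (λ i → recip (suc i))) (ℕ.*-identityʳ k)

  H≤log : ∀ k m → H k ≤ seq (log (suc k)) m
  H≤log k m = subst₂ _≤_ (riemannSum-1 k) (cong (riemannSum (suc k)) (ℕ.*-identityˡ (suc m)))
    (refine-lower (suc k) 0 m)

  log≤H+1 : ∀ k m → seq (log (suc k)) m ≤ H k + 1ℚ
  log≤H+1 k m = subst (λ z → seq (log (suc k)) m ≤ z + 1ℚ) (riemannSum-1 k)
    (riemannSum-close (suc k) m 0)

  abstract
    inverse : ∀ k → ∃ λ δ → (0ℚ < δ) × ((H k + 1ℚ) * δ ≡ 1ℚ)
    inverse k = scale 0<1 (ℚ.+-mono-≤-< (0≤H k) 0<1)

  -- At n = k + 1 the reciprocal of H k + 1, chosen so that (H k + 1)(1 + aδ) = H k + 1 + a: an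
  -- additive constant in np becomes a vanishing relative error.
  δ : ℕ → ℚ
  δ n = proj₁ (inverse (pred n))

  0≤δ : ∀ n → 0ℚ ≤ δ n
  0≤δ n = ℚ.<⇒≤ (proj₁ (proj₂ (inverse (pred n))))

  [H+1]δ≡1 : ∀ k → (H k + 1ℚ) * δ (suc k) ≡ 1ℚ
  [H+1]δ≡1 k = proj₂ (proj₂ (inverse k))

  δ≤recip : ∀ N k → ι (suc N) ≤ H k → δ (suc k) ≤ recip N
  δ≤recip N k large = begin
    d                         ≡⟨ ℚ.*-identityʳ d ⟨
    d * 1ℚ                    ≡⟨ cong (d *_) (ι-suc-recip N) ⟨
    d * (ι (suc N) * recip N) ≤⟨ *-monoˡ-≤ (0≤δ (suc k)) (*-monoʳ-≤ (0≤recip N) large′) ⟩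
    d * (h * recip N)         ≡⟨ solve 3 (λ d h r → d :* (h :* r) := h :* d :* r) refl d h
      (recip N) ⟩
    h * d * recip N           ≡⟨ trans (cong (_* recip N) ([H+1]δ≡1 k)) (ℚ.*-identityˡ (recip N)) ⟩
    recip N                   ∎
    where
    open ℚ.≤-Reasoning
    d = δ (suc k)
    h = H k + 1ℚ
    large′ : ι (suc N) ≤ h
    large′ = ℚ.≤-trans large (x≤x+y (H k) 0≤1)

  δ-small : ∀ ε → 0ℚ < ε → Eventually λ n → δ n ≤ ε
  δ-small ε 0<ε =
    let N , recip≤ε = archimedean ε 0<ε
        M , large   = H-unbounded (suc N)
    in suc M , λ where (suc k) (ℕ.s≤s M≤k) → ℚ.≤-trans (δ≤recip N k (large k M≤k)) recip≤ε

  aδ⟶0 : ∀ a → (λ n → fromℚ (a * δ n)) ⟶ 0ℝ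
  aδ⟶0 a ε 0<ε =
    -- The added 1 keeps the divisor positive when a = 0.
    let e , 0<e , Be≡ε = scale 0<ε {∣ a ∣ + 1ℚ} (ℚ.+-mono-≤-< (ℚ.0≤∣p∣ a) 0<1)
        N , small      = δ-small e 0<e
    in N , λ n N≤n ε′ 0<ε′ → 0 , λ _ _ → begin
      ∣ a * δ n - 0ℚ ∣      ≡⟨ cong ∣_∣ (solve 1 (λ x → x :- con 0ℚ := x) refl (a * δ n)) ⟩
      ∣ a * δ n ∣           ≡⟨ ℚ.∣p*q∣≡∣p∣*∣q∣ a (δ n) ⟩
      ∣ a ∣ * ∣ δ n ∣       ≡⟨ cong (∣ a ∣ *_) (ℚ.0≤p⇒∣p∣≡p (0≤δ n)) ⟩
      ∣ a ∣ * δ n           ≤⟨ *-mono-≤ (ℚ.0≤∣p∣ a) (x≤x+y ∣ a ∣ 0≤1) (ℚ.<⇒≤ 0<e) (small n N≤n) ⟩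
      (∣ a ∣ + 1ℚ) * e      ≡⟨ Be≡ε ⟩
      ε                     ≤⟨ x≤x+y ε (ℚ.<⇒≤ 0<ε′) ⟩
      ε + ε′                ∎
    where open ℚ.≤-Reasoning

  -- Because log n ≤ H k + 1, the assumed bound on p is at most (H k + 1)(1 - Cδ)/n = (H k + 1 -
  -- C)/n. The condition C ≤ H k keeps both this number and the factor 1 - Cδ nonnegative.
  lower-bound : ∀ k p {ε} → C ≤ H k → recip (suc k) ≤ ε → 0ℝ Defs.≤ p →
    p Defs.≤ (log (suc k) ÷ suc k) Defs.* (1ℝ Defs.+ fromℚ (- C * δ (suc k))) →
    Defs.∣ ℙ-cover (suc k) p Defs.- 0ℝ ∣ Defs.≤ fromℚ ε
  lower-bound k p {ε} C≤H small 0≤p p≤ = ∣ℙ-cover-l∣≤ε n p {0ℚ} {q} {0ℚ} 0≤q 0≤p p≤q λ t 0≤t t≤q →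
    let t≤1 = ℚ.≤-trans t≤q q≤1 in
    subst (_≤ ε)
      (sym (trans (cong ∣_∣ (solve 1 (λ x → x :- con 0ℚ := x) refl (coverProbability n t)))
                              (ℚ.0≤p⇒∣p∣≡p (0≤coverProbability n 0≤t t≤1))))
      (ℚ.≤-trans (coverProbability-upper k 0≤t t≤1
        (ℚ.≤-trans (*-monoˡ-≤ (0≤ι n) t≤q) (ℚ.≤-reflexive nq≡))) small)
    where
    open ℚ.≤-Reasoning
    n = suc k
    h = H k + 1ℚ
    d = δ n
    q = (h - C) * recip k
    C≤h : C ≤ h
    C≤h = ℚ.≤-trans C≤H (x≤x+y (H k) 0≤1)
    0≤q : 0ℚ ≤ q
    0≤q = 0≤* (≤⇒diff C≤h) (0≤recip k)
    nq≡ : ι n * q ≡ h - C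
    nq≡ = trans (solve 3 (λ n r x → n :* (x :* r) := x :* (n :* r)) refl (ι n) (recip k) (h - C))
      (trans (cong ((h - C) *_) (ι-suc-recip k)) (ℚ.*-identityʳ (h - C)))
    q≤1 : q ≤ 1ℚ
    q≤1 = begin
      (h - C) * recip k     ≤⟨ *-monoʳ-≤ (0≤recip k)
        (ℚ.≤-trans (subst (h - C ≤_) (ℚ.+-identityʳ h) (ℚ.+-monoʳ-≤ h (ℚ.neg-antimono-≤ 0≤C)))
                                 (ℚ.≤-trans (ℚ.+-monoˡ-≤ 1ℚ (H≤ι k))
                                   (ℚ.≤-reflexive (ℚ.+-comm (ι k) 1ℚ)))) ⟩
      ι n * recip k         ≡⟨ ι-suc-recip k ⟩
      1ℚ                    ∎
    0≤1-Cd : 0ℚ ≤ 1ℚ + - C * d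
    0≤1-Cd = subst (0ℚ ≤_)
      (trans (solve 3 (λ h c d → (h :- c) :* d := h :* d :+ (:- c) :* d) refl h C d)
        (cong (_+ - C * d) ([H+1]δ≡1 k)))
      (0≤* (≤⇒diff C≤h) (0≤δ n))
    p≤q : p Defs.≤ fromℚ q
    p≤q ε′ 0<ε′ =
      let N , hp = p≤ ε′ 0<ε′
      in N , λ m N≤m → ℚ.≤-trans (hp m N≤m) (ℚ.+-monoˡ-≤ ε′ (begin
      seq (log n) m * recip k * (1ℚ + - C * d)
        ≤⟨ *-monoʳ-≤ 0≤1-Cd (*-monoʳ-≤ (0≤recip k) (log≤H+1 k m)) ⟩
      h * recip k * (1ℚ + - C * d)
        ≡⟨ solve 4 (λ h r c d → h :* r :* (con 1ℚ :+ (:- c) :* d) := (h :- c :* (h :* d)) :* r) refl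
        h (recip k) C d ⟩
      (h - C * (h * d)) * recip k
        ≡⟨ cong (λ z → (h - C * z) * recip k) ([H+1]δ≡1 k) ⟩
      (h - C * 1ℚ) * recip k
        ≡⟨ cong (λ z → (h - z) * recip k) (ℚ.*-identityʳ C) ⟩
      q                                          ∎))

  upper-bound : ∀ l p {ε} → let k = suc l; n = suc k in 1ℚ ≤ H k → 2ℚ * recip k ≤ ε → p Defs.≤ 1ℝ →
    (log n ÷ n) Defs.* (1ℝ Defs.+ fromℚ (2ℚ * δ n)) Defs.≤ p →
    Defs.∣ ℙ-cover n p Defs.- 1ℝ ∣ Defs.≤ fromℚ ε
  upper-bound l p {ε} 1≤H small p≤1 ≤p = ∣ℙ-cover-l∣≤ε n p {q} {1ℚ} {1ℚ} q≤1 q≤p p≤1 λ t q≤t t≤1 →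
    let 0≤t = ℚ.≤-trans 0≤q q≤t in
    subst (_≤ ε) (sym (trans (∣-∣-swap (coverProbability n t) 1ℚ)
        (ℚ.0≤p⇒∣p∣≡p (≤⇒diff (coverProbability≤1 n 0≤t t≤1)))))
      (ℚ.≤-trans (coverProbability-lower l 0≤t t≤1
        (ℚ.≤-trans (ℚ.≤-reflexive (sym nq≡)) (*-monoˡ-≤ (0≤ι n) q≤t))) small)
    where
    open ℚ.≤-Reasoning
    k = suc l
    n = suc k
    h = H k + 1ℚ
    d = δ n
    q = h * recip k
    0≤q : 0ℚ ≤ q
    0≤q = 0≤* (0≤+ (0≤H k) 0≤1) (0≤recip k)
    nq≡ : ι n * q ≡ h
    nq≡ = trans (solve 3 (λ n r x → n :* (x :* r) := x :* (n :* r)) refl (ι n) (recip k) h)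
      (trans (cong (h *_) (ι-suc-recip k)) (ℚ.*-identityʳ h))
    q≤1 : q ≤ 1ℚ
    q≤1 = begin
      h * recip k      ≤⟨ *-monoʳ-≤ (0≤recip k)
        (ℚ.≤-trans (ℚ.+-monoˡ-≤ 1ℚ (H≤ι k)) (ℚ.≤-reflexive (ℚ.+-comm (ι k) 1ℚ))) ⟩
      ι n * recip k    ≡⟨ ι-suc-recip k ⟩
      1ℚ               ∎
    0≤1+2d : 0ℚ ≤ 1ℚ + 2ℚ * d
    0≤1+2d = 0≤+ 0≤1 (0≤* (0≤ι 2) (0≤δ n))
    -- The origin of the constant 2: log n is bounded below only by H k, and 2Hδ = 2H/(H+1) makes up
    -- the missing 1 once H ≥ 1. The two sides differ by (H - 1)δ.
    h≤ : h ≤ H k * (1ℚ + 2ℚ * d)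
    h≤ = diff⇒≤ (subst (0ℚ ≤_)
      (trans (solve 2 (λ H d → (H :- con 1ℚ) :* d :=
        H :* (con 1ℚ :+ con 2ℚ :* d) :- (H :+ (H :+ con 1ℚ) :* d)) refl (H k) d)
        (cong (λ z → H k * (1ℚ + 2ℚ * d) - (H k + z)) ([H+1]δ≡1 k)))
      (0≤* (≤⇒diff 1≤H) (0≤δ n)))
    q≤p : fromℚ q Defs.≤ p
    q≤p ε′ 0<ε′ =
      let N , hp = ≤p ε′ 0<ε′
      in N , λ m N≤m → ℚ.≤-trans (begin
      h * recip k                              ≤⟨ *-monoʳ-≤ (0≤recip k) h≤ ⟩
      H k * (1ℚ + 2ℚ * d) * recip k
        ≡⟨ solve 3 (λ a b c → a :* b :* c := a :* c :* b) refl (H k) (1ℚ + 2ℚ * d) (recip k) ⟩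
      H k * recip k * (1ℚ + 2ℚ * d)
        ≤⟨ *-monoʳ-≤ 0≤1+2d (*-monoʳ-≤ (0≤recip k) (H≤log k m)) ⟩
      seq (log n) m * recip k * (1ℚ + 2ℚ * d)  ∎) (hp m N≤m)

  lower-limit : ∀ (p : ℕ → ℝ) → (∀ n → (0ℝ Defs.≤ p n) × (p n Defs.≤ 1ℝ)) →
    Eventually (λ n → .{{_ : NonZero n}} → p n Defs.≤ log n ÷ n Defs.*
      (1ℝ Defs.+ fromℚ (- C * δ n))) →
    (λ n → ℙ-cover n (p n)) ⟶ 0ℝ
  lower-limit p p∈ (N₁ , p≤) ε 0<ε =
    let N₂ , small = archimedean ε 0<ε
        N₃ , large = H-unbounded K
    in suc (N₁ ℕ.⊔ N₂ ℕ.⊔ N₃) , λ where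
      (suc k) (ℕ.s≤s h) →
        let h₁₂ = ℕ.m⊔n≤o⇒m≤o (N₁ ℕ.⊔ N₂) N₃ h
        in lower-bound k (p (suc k))
             (subst (_≤ H k) ι-K (large k (ℕ.m⊔n≤o⇒n≤o (N₁ ℕ.⊔ N₂) N₃ h)))
             (ℚ.≤-trans (recip-anti (ℕ.m≤n⇒m≤1+n (ℕ.m⊔n≤o⇒n≤o N₁ N₂ h₁₂))) small)
             (proj₁ (p∈ (suc k)))
             (p≤ (suc k) (ℕ.m≤n⇒m≤1+n (ℕ.m⊔n≤o⇒m≤o N₁ N₂ h₁₂)))

  upper-limit : ∀ (p : ℕ → ℝ) → (∀ n → (0ℝ Defs.≤ p n) × (p n Defs.≤ 1ℝ)) →
    Eventually (λ n → .{{_ : NonZero n}} → log n ÷ n Defs.* (1ℝ Defs.+ fromℚ (2ℚ * δ n)) Defs.≤ p n) →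
    (λ n → ℙ-cover n (p n)) ⟶ 1ℝ
  upper-limit p p∈ (N₁ , ≤p) ε 0<ε =
    -- Half of ε, since the probability of not covering is bounded by 2/n.
    let N₂ , small = archimedean (½ * ε) (½-pos 0<ε)
        N₃ , large = H-unbounded 1
    in suc (suc (N₁ ℕ.⊔ N₂ ℕ.⊔ N₃)) , λ where
      (suc (suc l)) (ℕ.s≤s (ℕ.s≤s h)) →
        let h₁₂ = ℕ.m⊔n≤o⇒m≤o (N₁ ℕ.⊔ N₂) N₃ h
        in upper-bound l (p (suc (suc l)))
             (subst (_≤ H (suc l)) (ℚ.+-identityʳ 1ℚ)
               (large (suc l) (ℕ.m≤n⇒m≤1+n (ℕ.m⊔n≤o⇒n≤o (N₁ ℕ.⊔ N₂) N₃ h))))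
             (ℚ.≤-trans (*-monoˡ-≤ (0≤ι 2) (ℚ.≤-trans
               (recip-anti (ℕ.m≤n⇒m≤1+n (ℕ.m⊔n≤o⇒n≤o N₁ N₂ h₁₂))) small))
               (ℚ.≤-reflexive (solve 1 (λ ε → con 2ℚ :* (con ½ :* ε) := ε) refl ε)))
             (proj₂ (p∈ (suc (suc l))))
             (≤p (suc (suc l)) (ℕ.m≤n⇒m≤1+n (ℕ.m≤n⇒m≤1+n (ℕ.m⊔n≤o⇒m≤o N₁ N₂ h₁₂))))

open Convergence
open import Defs

theorem6 : ∃₂ λ (ε* ε : ℕ → ℝ) → (ε* ⟶ 0ℝ) × (ε ⟶ 0ℝ) ×
    (∀ (p : ℕ → ℝ) → (∀ n → (0ℝ ≤ p n) × (p n ≤ 1ℝ)) →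
    (Eventually (λ n → .{{_ : NonZero n}} → p n ≤ log n ÷ n * (1ℝ + ε* n)) →
    (λ n → ℙ-cover n (p n)) ⟶ 0ℝ) ×
    (Eventually (λ n → .{{_ : NonZero n}} → log n ÷ n * (1ℝ + ε n) ≤ p n) →
    (λ n → ℙ-cover n (p n)) ⟶ 1ℝ))
theorem6 = (λ n → fromℚ (ℚ.- C ℚ.* δ n)) , (λ n → fromℚ (2ℚ ℚ.* δ n)) , aδ⟶0 (ℚ.- C) , aδ⟶0 2ℚ ,
  λ p p∈ → lower-limit p p∈ , upper-limit p p∈
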